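{- Let $S$ denote the Shrikhande graph. For a positive integer $n$, there exists an $S$-design of order $n$ if and only if $n \equiv 1 \pmod{96}$.
   Context: The Shrikhande graph $S$ is the Cayley graph on the group $\mathbb{Z}_4 \times \mathbb{Z}_4$ with connection set $\{\pm(1,0), \pm(0,1), \pm(1,1)\}$. It is a 6-regular graph on 16 vertices with 48 edges, and it is strongly regular with parameters $(16,6,2,2)$. For simple graphs $F$ and $G$, a $G$-decomposition of $F$ is a partition of the edge set of $F$ into classes, each of which is the edge set of a subgraph of $F$ isomorphic to $G$. A $G$-design of order $n$ is a $G$-decomposition of the complete graph $K_n$; for $n=1$, the empty decomposition counts as a $G$-design. -}

module Defs where

open import Algebra.Bundles using (Group)
open import Algebra.Construct.DirectProduct using () renaming (group to _×ᴳ_)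
import Algebra.Properties.Group as GroupProperties
open import Data.Bool.Base using (Bool; T)
open import Data.Fin.Base using (Fin; zero; suc; toℕ)
open import Data.Fin.Properties using (_≟_; all?)
open import Data.List.Base using (List; []; _∷_)
open import Data.List.Relation.Unary.Any using (here; there)
import Data.List.Membership.Setoid as Membership
import Data.List.Membership.Setoid.Properties as MembershipProperties
open import Data.Nat.Base using (ℕ; _+_; _∸_)
open import Data.Nat.DivMod using (_mod_)
open import Data.Product using (Σ; _×_; _,_; proj₁; ∃!)
open import Function.Base using (_on_; _∘_)
open import Function.Bundles using (_↔_; _⇔_; Inverse)
open import Level using (0ℓ)
open import Relation.Binary.Core using (Rel)
open import Relation.Binary.Definitions using (Symmetric; Irreflexive)
open import Relation.Binary.PropositionalEquality using (_≡_; _≢_; refl; sym; cong; cong₂; isEquivalence)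
open import Relation.Nullary.Decidable using (from-yes)
open import Relation.Nullary.Negation using (¬_)

record SimpleGraph (V : Set) : Set₁ where
  field
    Adj    : Rel V 0ℓ
    symm   : Symmetric Adj
    irrefl : Irreflexive _≡_ Adj

open SimpleGraph public

complete : (n : ℕ) → SimpleGraph (Fin n)
complete n = record
  { Adj    = _≢_
  ; symm   = λ x≢y → x≢y ∘ sym
  ; irrefl = λ x≡y x≢y → x≢y x≡y
  }

record _≅_ {V W : Set} (G : SimpleGraph V) (H : SimpleGraph W) : Set where
  field
    bijection : V ↔ W
    adjacency : ∀ x y → Adj G x y ⇔ (Adj H on Inverse.to bijection) x y

-- The vertex set is Bool-valued so that the vertex type of the subgraph,
-- Σ V (T ∘ vertices), has exactly one element per vertex.
record Subgraph {V : Set} (F : SimpleGraph V) : Set₁ where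
  field
    vertices  : V → Bool
    Edge      : Rel V 0ℓ
    edge-sym  : Symmetric Edge
    edge⇒adj  : ∀ {x y} → Edge x y → Adj F x y
    edge⇒vert : ∀ {x y} → Edge x y → T (vertices x) × T (vertices y)

  Vertex : Set
  Vertex = Σ V (T ∘ vertices)

  graph : SimpleGraph Vertex
  graph = record
    { Adj    = Edge on proj₁
    ; symm   = edge-sym
    ; irrefl = λ x≡y e → irrefl F (cong proj₁ x≡y) (edge⇒adj e)
    }

-- The classes form a finite family, as F is meant to be a finite graph.
record Decomposition {V W : Set} (G : SimpleGraph W) (F : SimpleGraph V) : Set₁ where
  field
    size      : ℕ
    block     : Fin size → Subgraph F
    block≅    : ∀ i → Subgraph.graph (block i) ≅ G
    partition : ∀ {x y} → Adj F x y → ∃! _≡_ (λ i → Subgraph.Edge (block i) x y)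

Design : {W : Set} → SimpleGraph W → ℕ → Set₁
Design G n = Decomposition G (complete n)

module _ (𝔾 : Group 0ℓ 0ℓ) where
  open Group 𝔾 using (Carrier; _≈_; _⁻¹; ε; _\\_; setoid; inverseˡ)
  open Membership setoid using (_∈_)

  cayley : (C : List Carrier) → ¬ (ε ∈ C) → (∀ {x} → x ∈ C → (x ⁻¹) ∈ C) → SimpleGraph Carrier
  cayley C ε∉C C⁻¹⊆C = record
    { Adj    = λ x y → (x \\ y) ∈ C
    ; symm   = λ {x} {y} p → resp (⁻¹-anti-homo-\\ x y) (C⁻¹⊆C p)
    ; irrefl = λ { {x} refl p → ε∉C (resp (inverseˡ x) p) }
    }
    where
    open GroupProperties 𝔾 using (⁻¹-anti-homo-\\)
    resp : ∀ {x y} → x ≈ y → x ∈ C → y ∈ C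
    resp = MembershipProperties.∈-resp-≈ setoid

ℤ₄ : Group 0ℓ 0ℓ
ℤ₄ = record
  { Carrier = Fin 4
  ; _≈_     = _≡_
  ; _∙_     = _+₄_
  ; ε       = zero
  ; _⁻¹     = -₄_
  ; isGroup = record
    { isMonoid = record
      { isSemigroup = record
        { isMagma = record { isEquivalence = isEquivalence ; ∙-cong = cong₂ _+₄_ }
        ; assoc   = from-yes (all? λ x → all? λ y → all? λ z → ((x +₄ y) +₄ z) ≟ (x +₄ (y +₄ z)))
        }
      ; identity = from-yes (all? λ x → (zero +₄ x) ≟ x)
                 , from-yes (all? λ x → (x +₄ zero) ≟ x)
      }
    ; inverse = from-yes (all? λ x → ((-₄ x) +₄ x) ≟ zero)
              , from-yes (all? λ x → (x +₄ (-₄ x)) ≟ zero)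
    ; ⁻¹-cong = cong -₄_
    }
  }
  where
  _+₄_ : Fin 4 → Fin 4 → Fin 4
  x +₄ y = (toℕ x + toℕ y) mod 4
  -₄_ : Fin 4 → Fin 4
  -₄ x = (4 ∸ toℕ x) mod 4

ℤ₄×ℤ₄ : Group 0ℓ 0ℓ
ℤ₄×ℤ₄ = ℤ₄ ×ᴳ ℤ₄

open Group ℤ₄×ℤ₄ using () renaming (_⁻¹ to -_)
open Membership (Group.setoid ℤ₄×ℤ₄) using (_∈_)

connectionSet : List (Fin 4 × Fin 4)
connectionSet = (1₄ , 0₄) ∷ - (1₄ , 0₄)
              ∷ (0₄ , 1₄) ∷ - (0₄ , 1₄)
              ∷ (1₄ , 1₄) ∷ - (1₄ , 1₄) ∷ []
  where
  0₄ 1₄ : Fin 4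
  0₄ = zero
  1₄ = suc zero

shrikhande : SimpleGraph (Fin 4 × Fin 4)
shrikhande = cayley ℤ₄×ℤ₄ connectionSet ε∉C C⁻¹⊆C
  where
  ε∉C : ¬ ((zero , zero) ∈ connectionSet)
  ε∉C (here (() , _))
  ε∉C (there (here (() , _)))
  ε∉C (there (there (here (_ , ()))))
  ε∉C (there (there (there (here (_ , ())))))
  ε∉C (there (there (there (there (here (() , _))))))
  ε∉C (there (there (there (there (there (here (() , _)))))))

  C⁻¹⊆C : ∀ {x} → x ∈ connectionSet → (- x) ∈ connectionSet
  C⁻¹⊆C (here (refl , refl)) = there (here (refl , refl))
  C⁻¹⊆C (there (here (refl , refl))) = here (refl , refl)
  C⁻¹⊆C (there (there (here (refl , refl)))) = there (there (there (here (refl , refl))))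
  C⁻¹⊆C (there (there (there (here (refl , refl))))) = there (there (here (refl , refl)))
  C⁻¹⊆C (there (there (there (there (here (refl , refl)))))) = there (there (there (there (there (here (refl , refl))))))
  C⁻¹⊆C (there (there (there (there (there (here (refl , refl))))))) = there (there (there (there (here (refl , refl)))))

{-# OPTIONS --safe #-}
module Submission where

-- Necessity: the 6-valent stars of the blocks partition the n - 1 edges at a point, and the blocks partition the
-- n(n - 1)/2 edges of Kₙ, so 6 ∣ n - 1 and 96 ∣ n(n - 1), whence 96 ∣ n - 1.
--
-- Sufficiency, for n = 96k + 1: the complete 4-partite graph with parts of size 4 is the union of two Shrikhande
-- graphs, so a group divisible design with blocks of size 4 and u groups of size 24 yields, after giving every
-- point weight 4, a decomposition of the complete u-partite graph with parts of size 96. Such designs come from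
-- difference families for 4 ≤ u ≤ 19 and u = 43; adding one common point to the parts and filling them with a
-- design of order 97 settles k = u. Orders 97, 193 and 289 come from difference families over the additive groups
-- of the fields with that many elements; they were found by making a base block invariant under multiplication by
-- a primitive cube root of unity.
-- For all other k write k = 4m + t + s with t, s ≤ m and m prime to 6. The six linear forms a, a + b, …, a + 4b, b
-- modulo m give a transversal design on six groups of size m; shrinking two groups to sizes t and s leaves blocks
-- of sizes 4, 5 and 6. Giving weight 96 to all points reduces k to m, t and s.

open import Defs
open import Algebra.Bundles using (Group)
import Algebra.Properties.Group
open import Data.Bool.Base using (Bool; true; false; T; _∧_; not; if_then_else_)
open import Data.Bool.Properties using (T-∧; T-≡; T-irrelevant) renaming (_≟_ to _≟ᵇ_)
open import Data.Fin.Base as Fin using (Fin; zero; suc; toℕ; fromℕ<; combine; remQuot)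
open import Data.Fin.Patterns using (0F; 1F; 2F; 3F; 4F; 5F)
open import Data.Fin.Permutation using (↔⇒≡)
import Data.Fin.Properties as Fin
open import Data.Integer.Base using (ℤ; +_; -[1+_]; _+_; _-_; _*_; -_; _%ℕ_; _/ℕ_; _⊖_; ∣_∣)
open import Data.Integer.DivMod using (n%ℕd<d; a≡a%ℕn+[a/ℕn]*n)
open import Data.Integer.Divisibility.Signed using (divides; ∣⇒∣ᵤ)
import Data.Integer.Properties as ℤ
open import Data.Integer.Tactic.RingSolver using (solve-∀)
open import Data.List.Base as List using (List; []; _∷_)
open import Data.List.Membership.Propositional using (_∈_; find)
import Data.List.Membership.Propositional.Properties as List
open import Data.List.Membership.Setoid (Group.setoid ℤ₄×ℤ₄) using () renaming (_∈_ to _∈ₛ_)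
open import Data.List.Relation.Unary.Any as Any using (Any; here; there; any?; index)
import Data.List.Relation.Unary.Any.Properties as Any
open import Data.Maybe.Base as Maybe using (Maybe; just; nothing)
open import Data.Maybe.Properties using (just-injective)
open import Data.Nat.Base as ℕ using (ℕ; zero; suc; NonZero; _≡ᵇ_; _>_; _%_)
import Data.Nat.Divisibility as ℕ
import Data.Nat.DivMod as ℕ
open import Data.Nat.Induction using (<-rec)
import Data.Nat.Primality as ℕ
import Data.Nat.Properties as ℕ
open import Data.Nat.Tactic.RingSolver using () renaming (solve-∀ to solve-∀ℕ)
open import Data.Product using (Σ; ∃; ∃!; _×_; _,_; proj₁; proj₂; uncurry)
import Data.Product.Function.Dependent.Propositional as Σ
import Data.Product.Function.NonDependent.Propositional as ×
open import Data.Product.Properties using (≡-dec)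
open import Data.Product.Properties.WithK using (,-injectiveʳ)
open import Data.Sum.Base using (_⊎_; inj₁; inj₂; [_,_]′)
open import Data.Sum.Function.Propositional using (_⊎-↔_)
open import Data.Unit.Base using (⊤; tt)
open import Data.Vec.Base as Vec using (Vec; []; _∷_)
open import Function.Base using (_∘_; id; _on_)
open import Function.Bundles using (_↔_; _⇔_; mk↔ₛ′; mk⇔; Inverse; Equivalence)
open import Function.Properties.Inverse using (↔-sym; ↔-trans; ↔-refl)
open import Level using (0ℓ)
open import Relation.Binary.Core using (Rel)
open import Relation.Binary.Definitions using (DecidableEquality)
open import Relation.Binary.PropositionalEquality
open import Relation.Nullary.Decidable using (Dec; yes; no; does; ⌊_⌋; toWitness; fromWitness; from-yes; from-no; map′; ¬?; _⊎-dec_; _→-dec_)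
open import Relation.Nullary.Negation using (¬_; contradiction)

-- Finite types.

Finite : Set → Set
Finite A = ∃ λ n → A ↔ Fin n

Finite-Fin : ∀ {n} → Finite (Fin n)
Finite-Fin {n} = n , ↔-refl

Finite-⊎ : ∀ {A B} → Finite A → Finite B → Finite (A ⊎ B)
Finite-⊎ (m , A↔m) (n , B↔n) = m ℕ.+ n , ↔-trans (A↔m ⊎-↔ B↔n) (↔-sym Fin.+↔⊎)

Finite-resp : ∀ {A B} → A ↔ B → Finite B → Finite A
Finite-resp A↔B (n , B↔n) = n , ↔-trans A↔B B↔n

Σ-suc-↔ : ∀ {n} {C : Fin (suc n) → Set} → Σ (Fin (suc n)) C ↔ (C zero ⊎ Σ (Fin n) (C ∘ suc))
Σ-suc-↔ = mk↔ₛ′ (λ { (zero , c) → inj₁ c ; (suc i , c) → inj₂ (i , c) })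
                (λ { (inj₁ c) → zero , c ; (inj₂ (i , c)) → suc i , c })
                (λ { (inj₁ _) → refl ; (inj₂ _) → refl })
                (λ { (zero , _) → refl ; (suc _ , _) → refl })

Finite-Σ : ∀ {A} {B : A → Set} → Finite A → (∀ a → Finite (B a)) → Finite (Σ A B)
Finite-Σ (n , A↔n) finB =
  Finite-resp (↔-sym (Σ.Σ-↔ (↔-sym A↔n) ↔-refl)) (over-Fin n (finB ∘ Inverse.from A↔n))
  where
  over-Fin : ∀ n {C : Fin n → Set} → (∀ i → Finite (C i)) → Finite (Σ (Fin n) C)
  over-Fin zero    finC = 0 , mk↔ₛ′ (λ ()) (λ ()) (λ ()) (λ ())
  over-Fin (suc n) finC = Finite-resp Σ-suc-↔ (Finite-⊎ (finC zero) (over-Fin n (finC ∘ suc)))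

-- Partitions of relations into images of relations.

-- The maps g j : W j → V carry the arcs of the relations F j bijectively onto the arcs of E.
record Cover {V J : Set} {W : J → Set} (F : ∀ j → Rel (W j) 0ℓ) (E : Rel V 0ℓ) (g : ∀ j → W j → V) : Set where
  field
    sound  : ∀ j {u v} → F j u v → E (g j u) (g j v)
    exists : ∀ {x y} → E x y → ∃ λ j → ∃ λ u → ∃ λ v → F j u v × g j u ≡ x × g j v ≡ y
    unique : ∀ {j j′ u v u′ v′} → F j u v → F j′ u′ v′ → g j u ≡ g j′ u′ → g j v ≡ g j′ v′ →
             _≡_ {A = Σ J λ j → W j × W j} (j , u , v) (j′ , u′ , v′)

open Cover

-- Transitivity of decomposition: once the pieces of a graph are known, it is enough to decompose
-- each piece. Every recursive construction goes through this.
Cover-∘ : ∀ {V J : Set} {W : J → Set} {I : J → Set} {X : ∀ j → I j → Set}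
          {E : Rel V 0ℓ} {F : ∀ j → Rel (W j) 0ℓ} {H : ∀ j i → Rel (X j i) 0ℓ}
          {g : ∀ j → W j → V} {h : ∀ j i → X j i → W j} →
          Cover F E g → (∀ j → Cover (H j) (F j) (h j)) →
          Cover {J = Σ J I} (λ (j , i) → H j i) E (λ (j , i) x → g j (h j i x))
Cover-∘ c d .sound (j , i) Huv = sound c j (sound (d j) i Huv)
Cover-∘ c d .exists Exy with exists c Exy
... | j , _ , _ , Fuv , refl , refl with exists (d j) Fuv
... | i , u , v , Huv , refl , refl = (j , i) , u , v , Huv , refl , refl
Cover-∘ {W = W} {I = I} {X = X} c d .unique {j , i} {j′ , i′} Huv Hu′v′ eqᵘ eqᵛ
  with unique c (sound (d j) i Huv) (sound (d j′) i′ Hu′v′) eqᵘ eqᵛ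
... | p with cong proj₁ p
... | refl = cong {A = Σ (I j) λ i → X j i × X j i} (λ (i , u , v) → (j , i) , u , v)
                  (unique (d j) Huv Hu′v′ (cong proj₁ (,-injectiveʳ {B = λ j → W j × W j} p)) (cong proj₂ (,-injectiveʳ {B = λ j → W j × W j} p)))

Cover-resp : ∀ {V J : Set} {W : J → Set} {F : ∀ j → Rel (W j) 0ℓ} {E E′ : Rel V 0ℓ} {g : ∀ j → W j → V} →
             (∀ {x y} → E x y → E′ x y) → (∀ {x y} → E′ x y → E x y) → Cover F E g → Cover F E′ g
Cover-resp E⊆E′ E′⊆E c .sound j Fuv = E⊆E′ (sound c j Fuv)
Cover-resp E⊆E′ E′⊆E c .exists E′xy = exists c (E′⊆E E′xy)
Cover-resp E⊆E′ E′⊆E c .unique      = unique c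

↔-injective : ∀ {A B : Set} (A↔B : A ↔ B) → ∀ {x y} → Inverse.to A↔B x ≡ Inverse.to A↔B y → x ≡ y
↔-injective A↔B {x} {y} eq = trans (sym (strictlyInverseʳ x)) (trans (cong from eq) (strictlyInverseʳ y))
  where open Inverse A↔B

Cover-↔ : ∀ {V W : Set} {E : Rel V 0ℓ} {F : Rel W 0ℓ} (W↔V : W ↔ V) →
          (∀ {u v} → F u v → E (Inverse.to W↔V u) (Inverse.to W↔V v)) →
          (∀ {u v} → E (Inverse.to W↔V u) (Inverse.to W↔V v) → F u v) →
          Cover {J = ⊤} (λ _ → F) E (λ _ → Inverse.to W↔V)
Cover-↔ W↔V F⇒E E⇒F .sound _ = F⇒E
Cover-↔ {E = E} W↔V F⇒E E⇒F .exists {x} {y} Exy =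
  tt , from x , from y , E⇒F (subst₂ E (sym (strictlyInverseˡ x)) (sym (strictlyInverseˡ y)) Exy) ,
  strictlyInverseˡ x , strictlyInverseˡ y
  where open Inverse W↔V
Cover-↔ W↔V F⇒E E⇒F .unique _ _ eqᵘ eqᵛ = cong₂ (λ u v → tt , u , v) (↔-injective W↔V eqᵘ) (↔-injective W↔V eqᵛ)

-- The Shrikhande graph and its list of arcs.

Vertex : Set
Vertex = Fin 4 × Fin 4

infix 4 _~_

-- Wrapping adjacency in a record makes the endpoints inferable.
record _~_ (u v : Vertex) : Set where
  constructor adjacent
  field adjacency : Adj shrikhande u v

private
  module S = Group ℤ₄×ℤ₄
  module SP = Algebra.Properties.Group ℤ₄×ℤ₄

abstract
  ≈⇒≡ : ∀ {u v} → u S.≈ v → u ≡ v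
  ≈⇒≡ (refl , refl) = refl

  ∈⇒∈ₛ : ∀ {c} → c ∈ connectionSet → c ∈ₛ connectionSet
  ∈⇒∈ₛ = Any.map λ { refl → refl , refl }

  ∈ₛ⇒∈ : ∀ {c} → c ∈ₛ connectionSet → c ∈ connectionSet
  ∈ₛ⇒∈ = Any.map ≈⇒≡

  ~-∙ : ∀ u {c} → c ∈ connectionSet → u ~ (u S.∙ c)
  ~-∙ u {c} c∈C = adjacent (∈⇒∈ₛ (subst (_∈ connectionSet) (sym (≈⇒≡ (SP.\\-leftDividesʳ u c))) c∈C))

  ~⇒∙ : ∀ {u v} → u ~ v → ∃ λ c → c ∈ connectionSet × u S.∙ c ≡ v
  ~⇒∙ {u} {v} (adjacent u~v) = u S.\\ v , ∈ₛ⇒∈ u~v , ≈⇒≡ (SP.\\-leftDividesˡ u v)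

vertices : List Vertex
vertices = List.cartesianProduct (List.allFin 4) (List.allFin 4)

arcs : List (Vertex × Vertex)
arcs = List.cartesianProductWith (λ u c → u , u S.∙ c) vertices connectionSet

abstract
  ∈-vertices : ∀ u → u ∈ vertices
  ∈-vertices (a , b) = List.∈-cartesianProduct⁺ (List.∈-allFin a) (List.∈-allFin b)

  ~⇒∈-arcs : ∀ {u v} → u ~ v → (u , v) ∈ arcs
  ~⇒∈-arcs {u} u~v with ~⇒∙ u~v
  ... | c , c∈C , refl = List.∈-cartesianProductWith⁺ (λ u c → u , u S.∙ c) (∈-vertices u) c∈C

  ∈-arcs⇒~ : ∀ {u v} → (u , v) ∈ arcs → u ~ v
  ∈-arcs⇒~ uv∈arcs with List.∈-cartesianProductWith⁻ (λ u c → u , u S.∙ c) vertices connectionSet uv∈arcs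
  ... | u , c , _ , c∈C , refl = ~-∙ u c∈C

  -- By translation it is enough to find, for each d, some c such that c and d \\ c are both in the connection set.
  ~-common-neighbour : ∀ u v → ∃ λ w → u ~ w × v ~ w
  ~-common-neighbour u v =
    let c , c∈C , d\\c∈C = find (connecting (proj₁ (u S.\\ v)) (proj₂ (u S.\\ v)))
    in u S.∙ c , ~-∙ u c∈C , adjacent (∈⇒∈ₛ (subst (_∈ connectionSet) (≈⇒≡ (eq c)) d\\c∈C))
    where
    connecting : ∀ a b → Any (λ c → ((a , b) S.\\ c) ∈ connectionSet) connectionSet
    connecting = from-yes (Fin.all? λ a → Fin.all? λ b → any? (λ c → any? (≡-dec Fin._≟_ Fin._≟_ ((a , b) S.\\ c)) connectionSet) connectionSet)
    eq : ∀ c → (u S.\\ v) S.\\ c S.≈ v S.\\ (u S.∙ c)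
    eq c = S.trans (S.∙-congʳ (SP.⁻¹-anti-homo-\\ u v)) (S.assoc (v S.⁻¹) u c)

neighbour : Vertex → Fin 6 → Vertex
neighbour u c = u S.∙ List.lookup connectionSet c

abstract
  ~-neighbour : ∀ u c → u ~ neighbour u c
  ~-neighbour u c = ~-∙ u (List.∈-lookup c)

  ~⇒neighbour : ∀ {u v} → u ~ v → ∃ λ c → neighbour u c ≡ v
  ~⇒neighbour {u} u~v with ~⇒∙ u~v
  ... | c , c∈C , refl = index c∈C , cong (u S.∙_) (sym (Any.lookup-index c∈C))

  neighbour-injective : ∀ u {c c′} → neighbour u c ≡ neighbour u c′ → c ≡ c′
  neighbour-injective u {c} {c′} eq = table c c′ (≈⇒≡ (SP.∙-cancelˡ u _ _ (cong proj₁ eq , cong proj₂ eq)))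
    where
    table : ∀ c c′ → List.lookup connectionSet c ≡ List.lookup connectionSet c′ → c ≡ c′
    table = from-yes (Fin.all? λ c → Fin.all? λ c′ → ≡-dec Fin._≟_ Fin._≟_ (List.lookup connectionSet c) (List.lookup connectionSet c′) →-dec (c Fin.≟ c′))

-- Decompositions of a relation into Shrikhande graphs.

record Decomposable {V : Set} (E : Rel V 0ℓ) : Set₁ where
  field
    Index  : Set
    finite : Finite Index
    place  : Index → Vertex → V
    -- Arcs are covered instead of edges. Since `_~_` is symmetric, the two arcs of an edge lie in
    -- the same copy.
    cover  : Cover (λ _ → _~_) E place

open Decomposable

decompose : ∀ {V J : Set} {W : J → Set} {F : ∀ j → Rel (W j) 0ℓ} {E : Rel V 0ℓ} {g : ∀ j → W j → V} →
            Finite J → Cover F E g → (∀ j → Decomposable (F j)) → Decomposable E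
decompose {J = J} {g = g} finJ c D = record
  { Index  = Σ J (Index ∘ D)
  ; finite = Finite-Σ finJ (finite ∘ D)
  ; place  = λ (j , i) x → g j (place (D j) i x)
  ; cover  = Cover-∘ c (cover ∘ D)
  }

Decomposable-↔ : ∀ {V W : Set} {E : Rel V 0ℓ} {F : Rel W 0ℓ} (W↔V : W ↔ V) →
                 (∀ {u v} → F u v → E (Inverse.to W↔V u) (Inverse.to W↔V v)) →
                 (∀ {u v} → E (Inverse.to W↔V u) (Inverse.to W↔V v) → F u v) →
                 Decomposable F → Decomposable E
Decomposable-↔ W↔V F⇒E E⇒F D = decompose (1 , ↔-sym Fin.1↔⊤) (Cover-↔ W↔V F⇒E E⇒F) λ _ → D

-- Every vertex of the Shrikhande graph has a neighbour, so every point of a copy is the start of an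
-- arc of `E` and therefore has a preimage under `h`. This removes isolated points from `V`.
restrict : ∀ {U V : Set} {E : Rel V 0ℓ} (h : U → V) → (∀ {u v} → h u ≡ h v → u ≡ v) →
           (∀ {x y} → E x y → ∃ λ u → h u ≡ x) → Decomposable E → Decomposable (E on h)
restrict {U} {V} {E} h h-injective preimage D = record
  { Index = Index D ; finite = finite D ; place = place′ ; cover = cover′ }
  where
  lift : ∀ i x → ∃ λ u → h u ≡ place D i x
  lift i x = preimage (sound (cover D) i (~-neighbour x zero))
  place′ : Index D → Vertex → U
  place′ i x = proj₁ (lift i x)
  h-place′ : ∀ i x → h (place′ i x) ≡ place D i x
  h-place′ i x = proj₂ (lift i x)
  cover′ : Cover (λ _ → _~_) (E on h) place′
  cover′ .sound i {u} {v} u~v = subst₂ E (sym (h-place′ i u)) (sym (h-place′ i v)) (sound (cover D) i u~v)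
  cover′ .exists Exy with exists (cover D) Exy
  ... | i , u , v , u~v , eqᵘ , eqᵛ = i , u , v , u~v , h-injective (trans (h-place′ i u) eqᵘ) , h-injective (trans (h-place′ i v) eqᵛ)
  cover′ .unique {i} {i′} {u} {v} {u′} {v′} p p′ eqᵘ eqᵛ = unique (cover D) p p′
    (trans (sym (h-place′ i u)) (trans (cong h eqᵘ) (h-place′ i′ u′)))
    (trans (sym (h-place′ i v)) (trans (cong h eqᵛ) (h-place′ i′ v′)))

Decomposable-resp : ∀ {V : Set} {E E′ : Rel V 0ℓ} → (∀ {x y} → E x y → E′ x y) → (∀ {x y} → E′ x y → E x y) →
                    Decomposable E → Decomposable E′
Decomposable-resp E⊆E′ E′⊆E D = record
  { Index = Index D ; finite = finite D ; place = place D ; cover = Cover-resp E⊆E′ E′⊆E (cover D) }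

-- Arithmetic modulo N.

module Modular (N : ℕ) .{{_ : NonZero N}} where

  infix 4 _≈_

  record _≈_ (x y : ℤ) : Set where
    constructor congruent
    field
      quotient : ℤ
      equation : x - y ≡ quotient * + N

  ≈-reflexive : ∀ {x y} → x ≡ y → x ≈ y
  ≈-reflexive {x} refl = congruent (+ 0) (ℤ.+-inverseʳ x)

  ≈-sym : ∀ {x y} → x ≈ y → y ≈ x
  ≈-sym {x} {y} (congruent q eq) = congruent (- q) (begin
    y - x        ≡⟨ swap x y ⟩
    - (x - y)    ≡⟨ cong -_ eq ⟩
    - (q * + N)  ≡⟨ ℤ.neg-distribˡ-* q (+ N) ⟩
    - q * + N    ∎)
    where
    open ≡-Reasoning
    swap : ∀ x y → y - x ≡ - (x - y)
    swap = solve-∀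

  ≈-trans : ∀ {x y z} → x ≈ y → y ≈ z → x ≈ z
  ≈-trans {x} {y} {z} (congruent q eq) (congruent r eq′) = congruent (q + r) (begin
    x - z              ≡⟨ telescope x y z ⟩
    (x - y) + (y - z)  ≡⟨ cong₂ _+_ eq eq′ ⟩
    q * + N + r * + N  ≡⟨ ℤ.*-distribʳ-+ (+ N) q r ⟨
    (q + r) * + N      ∎)
    where
    open ≡-Reasoning
    telescope : ∀ x y z → x - z ≡ (x - y) + (y - z)
    telescope = solve-∀

  +-cong : ∀ {x x′ y y′} → x ≈ x′ → y ≈ y′ → x + y ≈ x′ + y′
  +-cong {x} {x′} {y} {y′} (congruent q eq) (congruent r eq′) = congruent (q + r) (begin
    (x + y) - (x′ + y′)    ≡⟨ regroup x x′ y y′ ⟩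
    (x - x′) + (y - y′)    ≡⟨ cong₂ _+_ eq eq′ ⟩
    q * + N + r * + N      ≡⟨ ℤ.*-distribʳ-+ (+ N) q r ⟨
    (q + r) * + N          ∎)
    where
    open ≡-Reasoning
    regroup : ∀ x x′ y y′ → (x + y) - (x′ + y′) ≡ (x - x′) + (y - y′)
    regroup = solve-∀

  *-congˡ : ∀ k {x y} → x ≈ y → k * x ≈ k * y
  *-congˡ k {x} {y} (congruent q eq) = congruent (k * q) (begin
    k * x - k * y    ≡⟨ distrib k x y ⟩
    k * (x - y)      ≡⟨ cong (k *_) eq ⟩
    k * (q * + N)    ≡⟨ ℤ.*-assoc k q (+ N) ⟨
    k * q * + N      ∎)
    where
    open ≡-Reasoning
    distrib : ∀ k x y → k * x - k * y ≡ k * (x - y)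
    distrib = solve-∀

  minus-cong : ∀ {x x′ y y′} → x ≈ x′ → y ≈ y′ → x - y ≈ x′ - y′
  minus-cong {y = y} {y′} p q = +-cong p (subst₂ _≈_ (ℤ.-1*i≡-i y) (ℤ.-1*i≡-i y′) (*-congˡ (- + 1) q))

  lift : Fin N → ℤ
  lift i = + toℕ i

  abstract
    ⟦_⟧ : ℤ → Fin N
    ⟦ x ⟧ = fromℕ< (n%ℕd<d x N)

    toℕ-⟦⟧ : ∀ x → toℕ ⟦ x ⟧ ≡ x %ℕ N
    toℕ-⟦⟧ x = Fin.toℕ-fromℕ< (n%ℕd<d x N)

  lift-⟦⟧ : ∀ x → lift ⟦ x ⟧ ≈ x
  lift-⟦⟧ x rewrite toℕ-⟦⟧ x = ≈-sym (congruent (x /ℕ N) (begin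
    x - + (x %ℕ N)                                 ≡⟨ cong (_- + (x %ℕ N)) (a≡a%ℕn+[a/ℕn]*n x N) ⟩
    + (x %ℕ N) + (x /ℕ N) * + N - + (x %ℕ N)       ≡⟨ cancel (+ (x %ℕ N)) ((x /ℕ N) * + N) ⟩
    (x /ℕ N) * + N                                 ∎))
    where
    open ≡-Reasoning
    cancel : ∀ r s → r + s - r ≡ s
    cancel = solve-∀

  -- Two residues in the range from 0 to N - 1 differ by less than N in absolute value, so their
  -- difference is a multiple of N only if it is 0.
  lift-injective : ∀ {i j} → lift i ≈ lift j → i ≡ j
  lift-injective {i} {j} (congruent q eqn) with ∣ lift i - lift j ∣ in eq | ∣⇒∣ᵤ (divides q eqn)
  ... | zero  | _   = Fin.toℕ-injective (ℤ.+-injective (ℤ.i-j≡0⇒i≡j (lift i) (lift j) (ℤ.∣i∣≡0⇒i≡0 eq)))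
  ... | suc d | N∣d = contradiction N∣d (ℕ.>⇒∤ (begin-strict
    suc d                     ≡⟨ eq ⟨
    ∣ lift i - lift j ∣       ≡⟨ cong ∣_∣ (ℤ.m-n≡m⊖n (toℕ i) (toℕ j)) ⟩
    ∣ toℕ i ⊖ toℕ j ∣       ≤⟨ ℤ.∣m⊝n∣≤m⊔n (toℕ i) (toℕ j) ⟩
    toℕ i ℕ.⊔ toℕ j           <⟨ ℕ.⊔-lub (Fin.toℕ<n i) (Fin.toℕ<n j) ⟩
    N                         ∎))
    where open ℕ.≤-Reasoning

  ⟦⟧-cong : ∀ {x y} → x ≈ y → ⟦ x ⟧ ≡ ⟦ y ⟧
  ⟦⟧-cong {x} {y} x≈y = lift-injective (≈-trans (lift-⟦⟧ x) (≈-trans x≈y (≈-sym (lift-⟦⟧ y))))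

  ⟦⟧-injective : ∀ {x y} → ⟦ x ⟧ ≡ ⟦ y ⟧ → x ≈ y
  ⟦⟧-injective {x} {y} eq = ≈-trans (≈-sym (lift-⟦⟧ x)) (≈-trans (≈-reflexive (cong lift eq)) (lift-⟦⟧ y))

  %ℕ-injective : ∀ x {y} → x %ℕ N ≡ toℕ ⟦ y ⟧ → x ≈ y
  %ℕ-injective x eq = ⟦⟧-injective (Fin.toℕ-injective (trans (toℕ-⟦⟧ x) eq))

  ⟦⟧-+-lift-cancel : ∀ x s t → ⟦ x + lift s ⟧ ≡ ⟦ x + lift t ⟧ → s ≡ t
  ⟦⟧-+-lift-cancel x s t eq = lift-injective (subst₂ _≈_ (cancel x (lift s)) (cancel x (lift t))
    (minus-cong (⟦⟧-injective eq) (≈-reflexive {x} refl)))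
    where
    cancel : ∀ x y → x + y - x ≡ y
    cancel = solve-∀

  ⟦⟧-difference : ∀ x y s → ⟦ lift ⟦ x + lift s ⟧ - lift ⟦ y + lift s ⟧ ⟧ ≡ ⟦ x - y ⟧
  ⟦⟧-difference x y s = ⟦⟧-cong (≈-trans (minus-cong (lift-⟦⟧ _) (lift-⟦⟧ _)) (≈-reflexive (cancel x y (lift s))))
    where
    cancel : ∀ x y z → x + z - (y + z) ≡ x - y
    cancel = solve-∀

  -- The shift `lift j - y` takes `y` to `j`; as `x` lies in the same relation to `y` as `i` to `j`,
  -- it also takes `x` to `i`.
  ⟦⟧-solve : ∀ x y i j → x - y ≈ lift i - lift j → ⟦ x + lift ⟦ lift j - y ⟧ ⟧ ≡ i
  ⟦⟧-solve x y i j x-y≈i-j = lift-injective (≈-trans (lift-⟦⟧ _)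
    (≈-trans (+-cong (≈-reflexive {x} refl) (lift-⟦⟧ _))
    (≈-trans (≈-reflexive (regroup x y (lift j)))
    (≈-trans (+-cong x-y≈i-j (≈-reflexive {lift j} refl)) (≈-reflexive (cancel (lift i) (lift j)))))))
    where
    regroup : ∀ x y z → x + (z - y) ≡ x - y + z
    regroup = solve-∀
    cancel : ∀ x y → x - y + y ≡ x
    cancel = solve-∀

  ≈⇒minus≈0 : ∀ {x y} → x ≈ y → x - y ≈ + 0
  ≈⇒minus≈0 {x} {y} (congruent q eq) = congruent q (trans (ℤ.+-identityʳ (x - y)) eq)

  minus≈0⇒≈ : ∀ {x y} → x - y ≈ + 0 → x ≈ y
  minus≈0⇒≈ {x} {y} (congruent q eq) = congruent q (trans (sym (ℤ.+-identityʳ (x - y))) eq)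

  ≈0⇒%≡0 : ∀ n → + n ≈ + 0 → n ℕ.% N ≡ 0
  ≈0⇒%≡0 n n≈0 = trans (sym (toℕ-⟦⟧ (+ n))) (trans (cong toℕ (⟦⟧-cong n≈0)) (trans (toℕ-⟦⟧ (+ 0)) (ℕ.m<n⇒m%n≡m (ℕ.>-nonZero⁻¹ N))))

  %≡0⇒≈0 : ∀ n → n ℕ.% N ≡ 0 → + n ≈ + 0
  %≡0⇒≈0 n eq = ⟦⟧-injective (Fin.toℕ-injective (trans (toℕ-⟦⟧ (+ n)) (trans eq (sym (trans (toℕ-⟦⟧ (+ 0)) (ℕ.m<n⇒m%n≡m (ℕ.>-nonZero⁻¹ N)))))))

  difference≡0⇒≡ : ∀ i j → toℕ ⟦ lift i - lift j ⟧ ≡ 0 → i ≡ j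
  difference≡0⇒≡ i j eq = lift-injective (minus≈0⇒≈ (≈-trans (≈-sym (lift-⟦⟧ _)) (≈-reflexive (cong +_ eq))))

  difference-self : ∀ i → toℕ ⟦ lift i - lift i ⟧ ≡ 0
  difference-self i = trans (toℕ-⟦⟧ _) (trans (cong (_%ℕ N) (ℤ.+-inverseʳ (lift i))) (ℕ.m<n⇒m%n≡m (ℕ.>-nonZero⁻¹ N)))

-- Checking partitions by counting.

hits : ℕ × ℕ → ℕ × ℕ → Bool
-- Most families below have first coordinates all 0, so a mismatch shows sooner in the second.
hits (a , b) (m , n) = (b ≡ᵇ n) ∧ (a ≡ᵇ m)

hits-sound : ∀ p d → T (hits p d) → p ≡ d
hits-sound (a , b) (m , n) t with Equivalence.to T-∧ t
... | b≡n , a≡m = cong₂ _,_ (ℕ.≡ᵇ⇒≡ a m a≡m) (ℕ.≡ᵇ⇒≡ b n b≡n)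

hits-refl : ∀ d → hits d d ≡ true
hits-refl (m , n) = Equivalence.to T-≡ (Equivalence.from T-∧ (ℕ.≡⇒≡ᵇ n n refl , ℕ.≡⇒≡ᵇ m m refl))

count : ℕ × ℕ → List (ℕ × ℕ) → ℕ
count d []       = 0
count d (p ∷ ps) = if hits p d then suc (count d ps) else count d ps

module _ {A : Set} (f : A → ℕ × ℕ) (d : ℕ × ℕ) where

  count-exists : ∀ as → count d (List.map f as) ≡ 1 → ∃ λ a → a ∈ as × f a ≡ d
  count-exists (a ∷ as) eq with hits (f a) d in hit
  ... | true  = a , here refl , hits-sound (f a) d (Equivalence.from T-≡ hit)
  ... | false with count-exists as eq
  ...   | b , b∈as , fb≡d = b , there b∈as , fb≡d

  count-zero : ∀ {as a} → count d (List.map f as) ≡ 0 → a ∈ as → f a ≢ d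
  count-zero {a ∷ as} eq (here refl) refl rewrite hits-refl (f a) = contradiction eq λ ()
  count-zero {b ∷ as} eq (there a∈as) fa≡d with hits (f b) d
  ... | false = count-zero eq a∈as fa≡d

  count-unique : ∀ {as a b} → count d (List.map f as) ≡ 1 → a ∈ as → b ∈ as → f a ≡ d → f b ≡ d → a ≡ b
  count-unique eq (here refl) (here refl) _ _ = refl
  count-unique {as = a ∷ as} eq (here refl) (there b∈as) refl fb≡d rewrite hits-refl (f a) =
    contradiction fb≡d (count-zero (ℕ.suc-injective eq) b∈as)
  count-unique {as = b ∷ as} eq (there a∈as) (here refl) fa≡d refl rewrite hits-refl (f b) =
    contradiction fa≡d (count-zero (ℕ.suc-injective eq) a∈as)
  count-unique {as = c ∷ as} eq (there a∈as) (there b∈as) fa≡d fb≡d with hits (f c) d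
  ... | false = count-unique eq a∈as b∈as fa≡d fb≡d
  ... | true  = contradiction fa≡d (count-zero (ℕ.suc-injective eq) a∈as)

allBelow : ℕ → (ℕ → Bool) → Bool
allBelow zero    p = true
allBelow (suc n) p = p n ∧ allBelow n p

allBelow-sound : ∀ {n} p → T (allBelow n p) → ∀ {i} → i ℕ.< n → T (p i)
allBelow-sound {suc n} p t {i} i<1+n with Equivalence.to T-∧ t | i ℕ.≟ n
... | pn , _    | yes refl = pn
... | _  , rest | no i≢n   = allBelow-sound p rest (ℕ.≤∧≢⇒< (ℕ.s≤s⁻¹ i<1+n) i≢n)

-- A count of 1 at an allowed key gives existence and uniqueness together, and a count of 0 at the
-- other keys gives soundness: these are the three fields of a `Cover`.
module Tally {A : Set} (as : List A) (key : A → ℕ × ℕ) (M N : ℕ) (allowed : ℕ → ℕ → Bool) where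

  expected : ℕ × ℕ → ℕ
  expected (m , n) = if allowed m n then 1 else 0

  -- The list of keys is an argument of agrees so that it is evaluated only once.
  check : Bool
  check = agrees (List.map key as)
    where
    agrees : List (ℕ × ℕ) → Bool
    agrees ps = allBelow M λ m → allBelow N λ n → count (m , n) ps ≡ᵇ expected (m , n)

  module _ (checked : T check) {m n} (m<M : m ℕ.< M) (n<N : n ℕ.< N) where

    private
      count≡expected : count (m , n) (List.map key as) ≡ expected (m , n)
      count≡expected = ℕ.≡ᵇ⇒≡ _ (expected (m , n)) (allBelow-sound _ (allBelow-sound _ checked m<M) n<N)

      count≡1 : T (allowed m n) → count (m , n) (List.map key as) ≡ 1
      count≡1 t with allowed m n | count≡expected
      ... | true | eq = eq

    key-allowed : ∀ {a} → a ∈ as → key a ≡ (m , n) → T (allowed m n)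
    key-allowed a∈as eq with allowed m n | count≡expected
    ... | true  | _   = _
    ... | false | eq₀ = contradiction eq (count-zero key _ eq₀ a∈as)

    key-exists : T (allowed m n) → ∃ λ a → a ∈ as × key a ≡ (m , n)
    key-exists t = count-exists key _ as (count≡1 t)

    key-unique : ∀ {a b} → a ∈ as → b ∈ as → key a ≡ (m , n) → key b ≡ (m , n) → a ≡ b
    key-unique a∈as b∈as eqᵃ eqᵇ = count-unique key _ (count≡1 (key-allowed a∈as eqᵃ)) a∈as b∈as eqᵃ eqᵇ

-- Difference families over a product of two cyclic groups.

module DifferenceFamily
  (M N : ℕ) .{{_ : NonZero M}} .{{_ : NonZero N}}
  {W : Set} {_⟶_ : Rel W 0ℓ} (arcList : List (W × W))
  (complete : ∀ {u v} → u ⟶ v → (u , v) ∈ arcList)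
  (correct  : ∀ {u v} → (u , v) ∈ arcList → u ⟶ v)
  {b : ℕ} (base : Fin b → W → ℕ × ℕ)
  (allowed : ℕ → ℕ → Bool)
  where

  private
    module ℤₘ = Modular M
    module ℤₙ = Modular N

  Point : Set
  Point = Fin M × Fin N

  Arc : Set
  Arc = Fin b × W × W

  allArcs : List Arc
  allArcs = List.cartesianProduct (List.allFin b) arcList

  difference : Arc → ℕ × ℕ
  difference (i , u , v) = (+ proj₁ (base i u) - + proj₁ (base i v)) %ℕ M
                         , (+ proj₂ (base i u) - + proj₂ (base i v)) %ℕ N

  open Tally allArcs difference M N allowed public

  _⊖ₚ_ : Point → Point → Point
  (a , c) ⊖ₚ (a′ , c′) = ℤₘ.⟦ ℤₘ.lift a - ℤₘ.lift a′ ⟧ , ℤₙ.⟦ ℤₙ.lift c - ℤₙ.lift c′ ⟧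

  E : Rel Point 0ℓ
  E x y = T (allowed (toℕ (proj₁ (x ⊖ₚ y))) (toℕ (proj₂ (x ⊖ₚ y))))

  translate : Fin b × Point → W → Point
  translate (i , s , t) u = ℤₘ.⟦ + proj₁ (base i u) + ℤₘ.lift s ⟧ , ℤₙ.⟦ + proj₂ (base i u) + ℤₙ.lift t ⟧

  module _ (checked : T check) where

    private
      toℕ² : Point → ℕ × ℕ
      toℕ² (a , c) = toℕ a , toℕ c

      ∈-allArcs : ∀ i {u v} → u ⟶ v → (i , u , v) ∈ allArcs
      ∈-allArcs i u⟶v = List.∈-cartesianProduct⁺ (List.∈-allFin i) (complete u⟶v)

      difference-translate : ∀ i s u v → difference (i , u , v) ≡ toℕ² (translate (i , s) u ⊖ₚ translate (i , s) v)
      difference-translate i (s , t) u v = sym (cong₂ _,_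
        (trans (cong toℕ (ℤₘ.⟦⟧-difference (+ proj₁ (base i u)) (+ proj₁ (base i v)) s)) (ℤₘ.toℕ-⟦⟧ _))
        (trans (cong toℕ (ℤₙ.⟦⟧-difference (+ proj₂ (base i u)) (+ proj₂ (base i v)) t)) (ℤₙ.toℕ-⟦⟧ _)))

      arc-allowed : ∀ z {a} → a ∈ allArcs → difference a ≡ toℕ² z → T (allowed (toℕ (proj₁ z)) (toℕ (proj₂ z)))
      arc-allowed (m , n) = key-allowed checked {toℕ m} {toℕ n} (Fin.toℕ<n m) (Fin.toℕ<n n)

      arc-exists : ∀ z → T (allowed (toℕ (proj₁ z)) (toℕ (proj₂ z))) → ∃ λ a → a ∈ allArcs × difference a ≡ toℕ² z
      arc-exists (m , n) = key-exists checked {toℕ m} {toℕ n} (Fin.toℕ<n m) (Fin.toℕ<n n)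

      arc-unique : ∀ z {a a′} → a ∈ allArcs → a′ ∈ allArcs → difference a ≡ toℕ² z → difference a′ ≡ toℕ² z → a ≡ a′
      arc-unique (m , n) = key-unique checked {toℕ m} {toℕ n} (Fin.toℕ<n m) (Fin.toℕ<n n)

      translate-solve : ∀ i u v x₁ x₂ y₁ y₂ → difference (i , u , v) ≡ toℕ² ((x₁ , x₂) ⊖ₚ (y₁ , y₂)) →
                        let s = ℤₘ.⟦ ℤₘ.lift y₁ - + proj₁ (base i v) ⟧
                            t = ℤₙ.⟦ ℤₙ.lift y₂ - + proj₂ (base i v) ⟧
                        in translate (i , s , t) u ≡ (x₁ , x₂)
      translate-solve i u v x₁ x₂ y₁ y₂ eq = cong₂ _,_
        (ℤₘ.⟦⟧-solve (+ proj₁ (base i u)) (+ proj₁ (base i v)) x₁ y₁ (ℤₘ.%ℕ-injective _ (cong proj₁ eq)))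
        (ℤₙ.⟦⟧-solve (+ proj₂ (base i u)) (+ proj₂ (base i v)) x₂ y₂ (ℤₙ.%ℕ-injective _ (cong proj₂ eq)))

      translate-self : ∀ i v y₁ y₂ →
                       let s = ℤₘ.⟦ ℤₘ.lift y₁ - + proj₁ (base i v) ⟧
                           t = ℤₙ.⟦ ℤₙ.lift y₂ - + proj₂ (base i v) ⟧
                       in translate (i , s , t) v ≡ (y₁ , y₂)
      translate-self i v y₁ y₂ = cong₂ _,_
        (ℤₘ.⟦⟧-solve (+ proj₁ (base i v)) (+ proj₁ (base i v)) y₁ y₁ (ℤₘ.≈-reflexive (cancel (+ proj₁ (base i v)) (ℤₘ.lift y₁))))
        (ℤₙ.⟦⟧-solve (+ proj₂ (base i v)) (+ proj₂ (base i v)) y₂ y₂ (ℤₙ.≈-reflexive (cancel (+ proj₂ (base i v)) (ℤₙ.lift y₂))))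
        where
        cancel : ∀ a c → a - a ≡ c - c
        cancel a c = trans (ℤ.+-inverseʳ a) (sym (ℤ.+-inverseʳ c))

      translate-cancel : ∀ {i i′ s s′ u v u′ v′} → (i , u , v) ≡ (i′ , u′ , v′) →
                         translate (i , s) u ≡ translate (i′ , s′) u′ →
                         _≡_ {A = (Fin b × Point) × W × W} ((i , s) , u , v) ((i′ , s′) , u′ , v′)
      translate-cancel {i} {s = s , t} {s′ , t′} {u} {v} refl eq = cong₂ (λ s t → (i , s , t) , u , v)
        (ℤₘ.⟦⟧-+-lift-cancel (+ proj₁ (base i u)) s s′ (cong proj₁ eq))
        (ℤₙ.⟦⟧-+-lift-cancel (+ proj₂ (base i u)) t t′ (cong proj₂ eq))

    -- Translation preserves differences, so the difference of two points singles out one arc of one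
    -- base block. The shift is then forced: it has to take the end `v` of that arc to the second
    -- point.
    translate-cover : Cover (λ _ → _⟶_) E translate
    translate-cover .sound (i , s) {u} {v} u⟶v =
      arc-allowed (translate (i , s) u ⊖ₚ translate (i , s) v) (∈-allArcs i u⟶v) (difference-translate i s u v)
    translate-cover .exists {x₁ , x₂} {y₁ , y₂} Exy =
      let (i , u , v) , arc∈ , eq = arc-exists ((x₁ , x₂) ⊖ₚ (y₁ , y₂)) Exy
      in (i , ℤₘ.⟦ ℤₘ.lift y₁ - + proj₁ (base i v) ⟧ , ℤₙ.⟦ ℤₙ.lift y₂ - + proj₂ (base i v) ⟧) , u , v ,
         correct (proj₂ (List.∈-cartesianProduct⁻ (List.allFin b) arcList arc∈)) ,
         translate-solve i u v x₁ x₂ y₁ y₂ eq , translate-self i v y₁ y₂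
    translate-cover .unique {i , s} {i′ , s′} {u} {v} {u′} {v′} p p′ eqᵘ eqᵛ = translate-cancel
      (arc-unique (translate (i , s) u ⊖ₚ translate (i , s) v) (∈-allArcs i p) (∈-allArcs i′ p′) (difference-translate i s u v)
        (trans (difference-translate i′ s′ u′ v′) (cong toℕ² (cong₂ _⊖ₚ_ (sym eqᵘ) (sym eqᵛ)))))
      eqᵘ

Complete : Set → Set₁
Complete V = Decomposable (_≢_ {A = V})

-- Here no group acts: the pair of endpoints of an arc is itself the key that is counted.
module ExplicitCover
  {V W : Set} {_⟶_ : Rel W 0ℓ} (arcList : List (W × W))
  (complete : ∀ {u v} → u ⟶ v → (u , v) ∈ arcList)
  (correct  : ∀ {u v} → (u , v) ∈ arcList → u ⟶ v)
  {b : ℕ} (put : Fin b → W → V) {n : ℕ} (code : V → Fin n) (code-injective : ∀ {x y} → code x ≡ code y → x ≡ y)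
  (allowed : ℕ → ℕ → Bool)
  where

  private
    allArcs : List (Fin b × W × W)
    allArcs = List.cartesianProduct (List.allFin b) arcList

    key : Fin b × W × W → ℕ × ℕ
    key (i , u , v) = toℕ (code (put i u)) , toℕ (code (put i v))

    ∈-allArcs : ∀ i {u v} → u ⟶ v → (i , u , v) ∈ allArcs
    ∈-allArcs i u⟶v = List.∈-cartesianProduct⁺ (List.∈-allFin i) (complete u⟶v)

  open Tally allArcs key n n allowed public

  explicit-cover : T check → Cover (λ _ → _⟶_) (λ x y → T (allowed (toℕ (code x)) (toℕ (code y)))) put
  explicit-cover checked .sound i {u} {v} u⟶v =
    key-allowed checked (Fin.toℕ<n (code (put i u))) (Fin.toℕ<n (code (put i v))) (∈-allArcs i u⟶v) refl
  explicit-cover checked .exists {x} {y} Exy =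
    let (i , u , v) , arc∈ , eq = key-exists checked (Fin.toℕ<n (code x)) (Fin.toℕ<n (code y)) Exy
    in i , u , v , correct (proj₂ (List.∈-cartesianProduct⁻ (List.allFin b) arcList arc∈)) ,
       code-injective (Fin.toℕ-injective (cong proj₁ eq)) , code-injective (Fin.toℕ-injective (cong proj₂ eq))
  explicit-cover checked .unique {i} {i′} {u} {v} p p′ eqᵘ eqᵛ =
    key-unique checked (Fin.toℕ<n (code (put i u))) (Fin.toℕ<n (code (put i v))) (∈-allArcs i p) (∈-allArcs i′ p′) refl
      (cong₂ _,_ (cong (toℕ ∘ code) (sym eqᵘ)) (cong (toℕ ∘ code) (sym eqᵛ)))

-- The complete 4-partite graph as two Shrikhande graphs.

-- The parts are the four cosets of 2(ℤ₄ × ℤ₄); the second copy of the Shrikhande graph is the Cayley graph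
-- of the elements ±(1,2), ±(1,-1), ±(2,1) outside 2(ℤ₄ × ℤ₄) that the first one leaves.
module FourPartite where

  open Group ℤ₄ using (_∙_)

  -- With a = 2q + r and b = 2q′ + r′, the parities r and r′ determine the coset, and q and q′ the
  -- place inside it.
  toCoset : Vertex → Fin 4 × Fin 4
  toCoset (a , b) with remQuot {2} 2 a | remQuot {2} 2 b
  ... | q , r | q′ , r′ = combine r r′ , combine q q′

  put : Fin 2 → Vertex → Fin 4 × Fin 4
  put zero       u       = toCoset u
  -- The automorphism (a, b) ↦ (a + b, 2a + 3b) has determinant 1 and sends (1,0), (0,1), (1,1) to
  -- (1,2), (1,-1), (2,1).
  put (suc zero) (a , b) = toCoset (a ∙ b , (a ∙ a) ∙ (b ∙ (b ∙ b)))

  code : Fin 4 × Fin 4 → Fin 16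
  code (c , p) = combine c p

  code-injective : ∀ {x y} → code x ≡ code y → x ≡ y
  code-injective {c , p} {c′ , p′} eq = uncurry (cong₂ _,_) (Fin.combine-injective c p c′ p′ eq)

  separated : ℕ → ℕ → Bool
  separated m n = not ((m ℕ./ 4) ≡ᵇ (n ℕ./ 4))

  abstract
    separated-code : ∀ c p c′ p′ → separated (toℕ (code (c , p))) (toℕ (code (c′ , p′))) ≡ not (does (c Fin.≟ c′))
    separated-code = from-yes (Fin.all? λ c → Fin.all? λ p → Fin.all? λ c′ → Fin.all? λ p′ →
      separated (toℕ (code (c , p))) (toℕ (code (c′ , p′))) ≟ᵇ not (does (c Fin.≟ c′)))

  separated⇒≢ : ∀ x y → T (separated (toℕ (code x)) (toℕ (code y))) → proj₁ x ≢ proj₁ y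
  separated⇒≢ (c , p) (c′ , p′) t rewrite separated-code c p c′ p′ with c Fin.≟ c′
  ... | no c≢c′ = c≢c′

  ≢⇒separated : ∀ x y → proj₁ x ≢ proj₁ y → T (separated (toℕ (code x)) (toℕ (code y)))
  ≢⇒separated (c , p) (c′ , p′) c≢c′ rewrite separated-code c p c′ p′ with c Fin.≟ c′
  ... | yes c≡c′ = c≢c′ c≡c′
  ... | no _     = _

  abstract
    put-cover : Cover (λ _ → _~_) (λ x y → T (separated (toℕ (code x)) (toℕ (code y)))) put
    put-cover = ExplicitCover.explicit-cover arcs ~⇒∈-arcs ∈-arcs⇒~ put code code-injective separated _

  fourPartite : Decomposable {Fin 4 × Fin 4} (_≢_ on proj₁)
  fourPartite = record
    { Index = Fin 2 ; finite = Finite-Fin ; place = put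
    ; cover = Cover-resp (λ {x} {y} → separated⇒≢ x y) (λ {x} {y} → ≢⇒separated x y) put-cover }

open FourPartite using (fourPartite)

T-not : ∀ {b} → b ≢ true → T (not b)
T-not {false} _    = _
T-not {true}  b≢t  = contradiction refl b≢t

-- Designs and group divisible designs from difference families.

nonzero : ℕ → ℕ → Bool
nonzero m n = not ((m ≡ᵇ 0) ∧ (n ≡ᵇ 0))

-- A base block is written as a 4 × 4 array, with the label of the vertex (x, y) in row x and column
-- y.
module CyclicDesign (M N : ℕ) .{{_ : NonZero M}} .{{_ : NonZero N}} {b : ℕ}
  (blocks : Vec (Vec (Vec (ℕ × ℕ) 4) 4) b) where

  private
    module ℤₘ = Modular M
    module ℤₙ = Modular N

    label : Fin b → Vertex → ℕ × ℕ
    label i (x , y) = Vec.lookup (Vec.lookup (Vec.lookup blocks i) x) y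

    open module F = DifferenceFamily M N arcs ~⇒∈-arcs ∈-arcs⇒~ label nonzero hiding (check)

    E⇒≢ : ∀ {x y} → E x y → x ≢ y
    E⇒≢ {a , c} t refl rewrite ℤₘ.difference-self a | ℤₙ.difference-self c = t

    ≢⇒E : ∀ {x y} → x ≢ y → E x y
    ≢⇒E {a , c} {a′ , c′} x≢y = T-not λ eq → let p , q = Equivalence.to T-∧ (Equivalence.from T-≡ eq) in
      x≢y (cong₂ _,_ (ℤₘ.difference≡0⇒≡ a a′ (ℕ.≡ᵇ⇒≡ _ 0 p)) (ℤₙ.difference≡0⇒≡ c c′ (ℕ.≡ᵇ⇒≡ _ 0 q)))

  check : Bool
  check = F.check

  design : T check → Complete (Fin M × Fin N)
  design checked = record
    { Index = Fin b × Fin M × Fin N ; finite = Finite-Σ Finite-Fin λ _ → Finite-Σ Finite-Fin λ _ → Finite-Fin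
    ; place = translate ; cover = Cover-resp E⇒≢ ≢⇒E (translate-cover checked) }

Complete-↔ : ∀ {V W : Set} → W ↔ V → Complete W → Complete V
Complete-↔ W↔V = Decomposable-↔ W↔V (λ u≢v eq → u≢v (↔-injective W↔V eq)) (λ neq → neq ∘ cong (Inverse.to W↔V))

-- Wilson's construction with constant weight: each point is replaced by a copy of `X`, and a block
-- on 4 points becomes a complete 4-partite graph.
Cover-× : ∀ {V J W X : Set} {F : Rel W 0ℓ} {E : Rel V 0ℓ} {g : J → W → V} → Cover (λ _ → F) E g →
          Cover {W = λ _ → W × X} (λ _ → F on proj₁) (E on proj₁) (λ j (w , x) → g j w , x)
Cover-× c .sound j Fuv = sound c j Fuv
Cover-× c .exists {_ , p} {_ , q} Exy with exists c Exy
... | j , u , v , Fuv , refl , refl = j , (u , p) , (v , q) , Fuv , refl , refl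
Cover-× c .unique {j} {j′} {u , p} {v , q} {u′ , p′} {v′ , q′} Fuv Fu′v′ eqᵘ eqᵛ
  with unique c Fuv Fu′v′ (cong proj₁ eqᵘ) (cong proj₁ eqᵛ) | cong proj₂ eqᵘ | cong proj₂ eqᵛ
... | refl | refl | refl = refl

Multipartite : ℕ → Set₁
Multipartite u = Decomposable {Fin u × Fin 96} (_≢_ on proj₁)

fin4Arcs : List (Fin 4 × Fin 4)
fin4Arcs = List.filter (λ (i , j) → ¬? (i Fin.≟ j)) (List.cartesianProduct (List.allFin 4) (List.allFin 4))

≢⇒∈-fin4Arcs : ∀ {i j} → i ≢ j → (i , j) ∈ fin4Arcs
≢⇒∈-fin4Arcs {i} {j} i≢j =
  List.∈-filter⁺ (λ (i , j) → ¬? (i Fin.≟ j)) (List.∈-cartesianProduct⁺ (List.∈-allFin i) (List.∈-allFin j)) i≢j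

∈-fin4Arcs⇒≢ : ∀ {i j} → (i , j) ∈ fin4Arcs → i ≢ j
∈-fin4Arcs⇒≢ ij∈ = proj₂ (List.∈-filter⁻ (λ (i , j) → ¬? (i Fin.≟ j))
  {xs = List.cartesianProduct (List.allFin 4) (List.allFin 4)} ij∈)

-- The groups of the design on ℤ_M × ℤ_qu are the residue classes of the second coordinate modulo u.
module CyclicGDD (M q u : ℕ) .{{_ : NonZero M}} .{{_ : NonZero q}} .{{_ : NonZero u}} (eq96 : M ℕ.* (q ℕ.* 4) ≡ 96)
  {b : ℕ} (blocks : Vec (Vec (ℕ × ℕ) 4) b) where

  private
    instance
      q*u≢0 : NonZero (q ℕ.* u)
      q*u≢0 = ℕ.m*n≢0 q u

    module ℤᵤ = Modular u
    module ℤₙ = Modular (q ℕ.* u)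

    label : Fin b → Fin 4 → ℕ × ℕ
    label i x = Vec.lookup (Vec.lookup blocks i) x

    apart : ℕ → ℕ → Bool
    apart m n = not ((n ℕ.% u) ≡ᵇ 0)

    open module F = DifferenceFamily M (q ℕ.* u) fin4Arcs ≢⇒∈-fin4Arcs ∈-fin4Arcs⇒≢ label apart hiding (check)

    quotient : Fin (q ℕ.* u) → Fin q
    quotient c = proj₁ (remQuot {q} u c)

    part : Fin (q ℕ.* u) → Fin u
    part c = proj₂ (remQuot {q} u c)

    weaken : ∀ {x y} → x ℤₙ.≈ y → x ℤᵤ.≈ y
    weaken (ℤₙ.congruent k eq) = ℤᵤ.congruent (k * + q) (trans eq (trans (cong (k *_) (ℤ.pos-* q u)) (sym (ℤ.*-assoc k (+ q) (+ u)))))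

    lift-part : ∀ c → ℤₙ.lift c ℤᵤ.≈ ℤᵤ.lift (part c)
    lift-part c = ℤᵤ.congruent (+ toℕ (quotient c)) (begin
      + toℕ c - + toℕ (part c)                                                 ≡⟨ cong (λ z → + z - + toℕ (part c)) eq ⟩
      + (u ℕ.* toℕ (quotient c) ℕ.+ toℕ (part c)) - + toℕ (part c)             ≡⟨ cong (_- + toℕ (part c)) (ℤ.pos-+ (u ℕ.* toℕ (quotient c)) (toℕ (part c))) ⟩
      + (u ℕ.* toℕ (quotient c)) + + toℕ (part c) - + toℕ (part c)             ≡⟨ cong (λ z → z + + toℕ (part c) - + toℕ (part c)) (ℤ.pos-* u (toℕ (quotient c))) ⟩
      + u * + toℕ (quotient c) + + toℕ (part c) - + toℕ (part c)               ≡⟨ cancel (+ u) (+ toℕ (quotient c)) (+ toℕ (part c)) ⟩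
      + toℕ (quotient c) * + u                                                 ∎)
      where
      open ≡-Reasoning
      eq : toℕ c ≡ u ℕ.* toℕ (quotient c) ℕ.+ toℕ (part c)
      eq = trans (cong toℕ (sym (Fin.combine-remQuot {q} u c))) (Fin.toℕ-combine (quotient c) (part c))
      cancel : ∀ x y z → x * y + z - z ≡ y * x
      cancel = solve-∀

    -- As u divides q u, differences modulo q u can be reduced modulo u; the test `apart` therefore
    -- compares the groups of two points.
    difference≈ : ∀ c c′ → ℤₙ.lift ℤₙ.⟦ ℤₙ.lift c - ℤₙ.lift c′ ⟧ ℤᵤ.≈ ℤᵤ.lift (part c) - ℤᵤ.lift (part c′)
    difference≈ c c′ = ℤᵤ.≈-trans (weaken (ℤₙ.lift-⟦⟧ _)) (ℤᵤ.minus-cong (lift-part c) (lift-part c′))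

    E⇒≢ : ∀ {x y} → E x y → part (proj₂ x) ≢ part (proj₂ y)
    E⇒≢ {a , c} {a′ , c′} t eq = lemma t (ℤᵤ.≈0⇒%≡0 _ (ℤᵤ.≈-trans (difference≈ c c′)
      (ℤᵤ.≈⇒minus≈0 (ℤᵤ.≈-reflexive (cong ℤᵤ.lift eq)))))
      where
      lemma : ∀ {n} → T (not (n ≡ᵇ 0)) → n ≢ 0
      lemma t refl = t

    ≢⇒E : ∀ {x y} → part (proj₂ x) ≢ part (proj₂ y) → E x y
    ≢⇒E {a , c} {a′ , c′} neq = T-not λ eq → neq (ℤᵤ.lift-injective (ℤᵤ.minus≈0⇒≈ (ℤᵤ.≈-trans (ℤᵤ.≈-sym (difference≈ c c′))
      (ℤᵤ.%≡0⇒≈0 _ (ℕ.≡ᵇ⇒≡ _ 0 (Equivalence.from T-≡ eq))))))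

    -- A group has M q points, namely M choices of the first coordinate and q of the second within
    -- its residue class; weight 4 turns them into 96.
    points : (Point × Fin 4) ↔ (Fin u × Fin (M ℕ.* (q ℕ.* 4)))
    points = mk↔ₛ′
      (λ ((a , c) , w) → part c , combine a (combine (quotient c) w))
      (λ (g , z) → let a , z′ = remQuot {M} (q ℕ.* 4) z ; i , w = remQuot {q} 4 z′ in (a , combine i g) , w)
      (λ (g , z) → let a , z′ = remQuot {M} (q ℕ.* 4) z ; i , w = remQuot {q} 4 z′ ; eq = Fin.remQuot-combine {q} i g in
        cong₂ _,_ (cong proj₂ eq)
          (trans (cong (λ j → combine a (combine j w)) (cong proj₁ eq))
          (trans (cong (combine a) (Fin.combine-remQuot {q} 4 z′)) (Fin.combine-remQuot {M} (q ℕ.* 4) z))))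
      (λ ((a , c) , w) → let eq = Fin.remQuot-combine {M} a (combine (quotient c) w) ; eq′ = Fin.remQuot-combine {q} (quotient c) w in
        trans (cong (λ (a , z) → (a , combine (proj₁ (remQuot {q} 4 z)) (part c)) , proj₂ (remQuot {q} 4 z)) eq)
        (trans (cong (λ (i , w) → (a , combine i (part c)) , w) eq′)
               (cong (λ c → (a , c) , w) (Fin.combine-remQuot {q} u c))))

  check : Bool
  check = F.check

  multipartite : T check → Multipartite u
  multipartite checked = subst (λ n → Decomposable {Fin u × Fin n} (_≢_ on proj₁)) eq96
    (Decomposable-↔ points id id
      (decompose (Finite-Σ Finite-Fin λ _ → Finite-Σ Finite-Fin λ _ → Finite-Fin)
                 (Cover-× (Cover-resp (λ {x} {y} → E⇒≢ {x} {y}) (λ {x} {y} → ≢⇒E {x} {y}) (translate-cover checked)))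
                 λ _ → fourPartite))

-- Filling the groups of a multipartite decomposition.

module _ {G : Set} (_≟_ : DecidableEquality G) {Y : G → Set} where

  private
    -- As an index, `nothing` is the multipartite graph between the groups and `just g` the complete
    -- graph on group `g` and the common point. As a vertex, `nothing` is the common point.
    Piece : Maybe G → Set
    Piece nothing  = Σ G Y
    Piece (just g) = Maybe (Y g)

    Within : ∀ j → Rel (Piece j) 0ℓ
    Within nothing  = _≢_ on proj₁
    Within (just g) = _≢_

    include : ∀ j → Piece j → Maybe (Σ G Y)
    include nothing  = just
    include (just g) = Maybe.map (g ,_)

    include-injective : ∀ g {u v} → include (just g) u ≡ include (just g) v → u ≡ v
    include-injective g {just _}  {just _}  refl = refl
    include-injective g {nothing} {nothing} refl = refl

    same-group : ∀ g {u g′ y} → include (just g) u ≡ just (g′ , y) → g ≡ g′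
    same-group g {just _} refl = refl

    -- Of two distinct points at least one differs from the common point, and that one determines
    -- the group.
    groups-agree : ∀ g g′ {u v u′ v′} → u ≢ v → include (just g) u ≡ include (just g′) u′ →
                   include (just g) v ≡ include (just g′) v′ → g ≡ g′
    groups-agree _ _ {u = just _}  {u′ = just _}                           _   refl _    = refl
    groups-agree _ _ {u = nothing} {just _}  {nothing} {just _}            _   _    refl = refl
    groups-agree _ _ {u = nothing} {nothing}                               u≢v _    _    = contradiction refl u≢v

  fill-cover : Cover Within _≢_ include
  fill-cover .sound nothing  g≢h eq = g≢h (cong proj₁ (just-injective eq))
  fill-cover .sound (just g) u≢v eq = u≢v (include-injective g eq)
  fill-cover .exists {nothing}      {nothing}      x≢y = contradiction refl x≢y
  fill-cover .exists {nothing}      {just (g , y)} _   = just g , nothing , just y , (λ ()) , refl , refl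
  fill-cover .exists {just (g , x)} {nothing}      _   = just g , just x , nothing , (λ ()) , refl , refl
  fill-cover .exists {just (g , x)} {just (h , y)} x≢y with g ≟ h
  ... | yes refl = just g , just x , just y , (λ eq → x≢y (cong (Maybe.map (g ,_)) eq)) , refl , refl
  ... | no  g≢h  = nothing , (g , x) , (h , y) , g≢h , refl , refl
  fill-cover .unique {nothing} {nothing} _ _ refl refl = refl
  fill-cover .unique {nothing} {just g} {u′ = u′} {v′} g≢h _ eqᵘ eqᵛ =
    contradiction (trans (sym (same-group g {u′} (sym eqᵘ))) (same-group g {v′} (sym eqᵛ))) g≢h
  fill-cover .unique {just g} {nothing} {u} {v} _ g≢h eqᵘ eqᵛ =
    contradiction (trans (sym (same-group g {u} eqᵘ)) (same-group g {v} eqᵛ)) g≢h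
  fill-cover .unique {just g} {just g′} {u} {v} {u′} {v′} u≢v _ eqᵘ eqᵛ with groups-agree g g′ {u} {v} {u′} {v′} u≢v eqᵘ eqᵛ
  ... | refl = cong₂ (λ u v → just g , u , v) (include-injective g {u} {u′} eqᵘ) (include-injective g {v} {v′} eqᵛ)

  fill : Finite (Maybe G) → (∀ g → Complete (Maybe (Y g))) → Decomposable {Σ G Y} (_≢_ on proj₁) → Complete (Maybe (Σ G Y))
  fill fin groups across = decompose fin fill-cover λ { nothing → across ; (just g) → groups g }

Maybe-Fin-↔ : ∀ {n} → Maybe (Fin n) ↔ Fin (suc n)
Maybe-Fin-↔ = mk↔ₛ′ (λ { nothing → zero ; (just i) → suc i }) (λ { zero → nothing ; (suc i) → just i })
                    (λ { zero → refl ; (suc _) → refl }) (λ { nothing → refl ; (just _) → refl })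

Maybe-↔ : ∀ {A B : Set} → A ↔ B → Maybe A ↔ Maybe B
Maybe-↔ A↔B = mk↔ₛ′ (Maybe.map to) (Maybe.map from)
  (λ { nothing → refl ; (just b) → cong just (strictlyInverseˡ b) })
  (λ { nothing → refl ; (just a) → cong just (strictlyInverseʳ a) })
  where open Inverse A↔B

-- A decomposition of order 96 k + 1, in which nothing is the point shared by the filled parts.
Good : ℕ → Set₁
Good k = Complete (Maybe (Fin k × Fin 96))

-- This design of order 1 also fills a group that has been truncated to size 0.
good-0 : Good 0
good-0 = record
  { Index = Fin 0 ; finite = Finite-Fin ; place = λ ()
  ; cover = record { sound = λ () ; exists = λ { {nothing} {nothing} neq → contradiction refl neq } ; unique = λ { {()} } } }

good-× : ∀ k M N → M ℕ.* N ≡ suc (k ℕ.* 96) → Complete (Fin M × Fin N) → Good k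
good-× k M N eq = Complete-↔ (↔-trans (subst (λ n → (Fin M × Fin N) ↔ Fin n) eq (↔-sym Fin.*↔×))
  (↔-sym (↔-trans (Maybe-↔ (↔-sym Fin.*↔×)) Maybe-Fin-↔)))

Multipartite⇒Good : ∀ {u} → Good 1 → Multipartite u → Good u
Multipartite⇒Good {u} good-1 = fill Fin._≟_ (suc u , Maybe-Fin-↔) λ _ →
  Complete-↔ (Maybe-↔ (mk↔ₛ′ (λ (_ , p) → p) (zero ,_) (λ _ → refl) (λ { (zero , _) → refl }))) good-1

-- Transversal designs from linear forms.

module Transversal (m : ℕ) .{{_ : NonZero m}} (c : ℤ) (12c≈1 : Modular._≈_ m (+ 12 * c) (+ 1)) where

  open Modular m

  α β : Fin 6 → ℤ
  α = Vec.lookup (+ 1 ∷ + 1 ∷ + 1 ∷ + 1 ∷ + 1 ∷ + 0 ∷ [])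
  β = Vec.lookup (+ 0 ∷ + 1 ∷ + 2 ∷ + 3 ∷ + 4 ∷ + 1 ∷ [])

  form : Fin 6 → ℤ → ℤ → ℤ
  form g a b = α g * a + β g * b

  -- For g and h below 5 this is h - g, and for exactly one of them equal to 5 it is 1 or -1. For g
  -- ≠ h it thus divides 12 and is a unit modulo m.
  det : Fin 6 → Fin 6 → ℤ
  det g h = α g * β h - α h * β g

  -- The quotient of 12 by the determinant, and junk where the latter is 0.
  codet : Fin 6 → Fin 6 → ℤ
  codet g h with det g h
  ... | + n      = + 12 /ℕ suc (n ℕ.∸ 1)
  ... | -[1+ n ] = - (+ 12 /ℕ suc n)

  abstract
    det-codet : ∀ g h → g ≢ h → det g h * codet g h ≡ + 12
    det-codet g h g≢h = [ (λ g≡h → contradiction g≡h g≢h) , id ]′ (table g h)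
      where
      table : ∀ g h → g ≡ h ⊎ det g h * codet g h ≡ + 12
      table = from-yes (Fin.all? λ g → Fin.all? λ h → (g Fin.≟ h) ⊎-dec (det g h * codet g h ℤ.≟ + 12))

  -- `c * codet g h` is the inverse of the determinant: determinant times codeterminant is 12, whose
  -- inverse is `c`.
  det-unit : ∀ {g h} → g ≢ h → ∀ x → c * codet g h * (det g h * x) ≈ x
  det-unit {g} {h} g≢h x = subst₂ _≈_
    (begin
      x * (+ 12 * c)                     ≡⟨ cong (λ z → x * (z * c)) (det-codet g h g≢h) ⟨
      x * (det g h * codet g h * c)      ≡⟨ regroup (det g h) (codet g h) c x ⟩
      c * codet g h * (det g h * x)      ∎)
    (ℤ.*-identityʳ x)
    (*-congˡ x 12c≈1)
    where
    open ≡-Reasoning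
    regroup : ∀ d e c x → x * (d * e * c) ≡ c * e * (d * x)
    regroup = solve-∀

  ≈-cancel-det : ∀ {g h x y} → g ≢ h → det g h * x ≈ det g h * y → x ≈ y
  ≈-cancel-det {g} {h} {x} {y} g≢h dx≈dy =
    ≈-trans (≈-sym (det-unit g≢h x)) (≈-trans (*-congˡ (c * codet g h) dx≈dy) (det-unit g≢h y))

  form-cong : ∀ g {a a′ b b′} → a ≈ a′ → b ≈ b′ → form g a b ≈ form g a′ b′
  form-cong g p q = +-cong (*-congˡ (α g) p) (*-congˡ (β g) q)

  abstract
    point : Fin m × Fin m → Fin 6 → Fin m
    point (a , b) g = ⟦ form g (lift a) (lift b) ⟧

    -- By Cramer's rule.
    point-unique : ∀ {g h} → g ≢ h → ∀ {ℓ ℓ′} → point ℓ g ≡ point ℓ′ g → point ℓ h ≡ point ℓ′ h → ℓ ≡ ℓ′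
    point-unique {g} {h} g≢h {a , b} {a′ , b′} eqᵍ eqʰ = cong₂ _,_
      (lift-injective (≈-cancel-det {g} {h} g≢h (subst₂ _≈_ (solve-a (α g) (β g) (α h) (β h) (lift a) (lift b)) (solve-a (α g) (β g) (α h) (β h) (lift a′) (lift b′))
        (minus-cong (*-congˡ (β h) (⟦⟧-injective eqᵍ)) (*-congˡ (β g) (⟦⟧-injective eqʰ))))))
      (lift-injective (≈-cancel-det {g} {h} g≢h (subst₂ _≈_ (solve-b (α g) (β g) (α h) (β h) (lift a) (lift b)) (solve-b (α g) (β g) (α h) (β h) (lift a′) (lift b′))
        (minus-cong (*-congˡ (α g) (⟦⟧-injective eqʰ)) (*-congˡ (α h) (⟦⟧-injective eqᵍ))))))
      where
      solve-a : ∀ p q p′ q′ a b → q′ * (p * a + q * b) - q * (p′ * a + q′ * b) ≡ (p * q′ - p′ * q) * a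
      solve-a = solve-∀
      solve-b : ∀ p q p′ q′ a b → p * (p′ * a + q′ * b) - p′ * (p * a + q * b) ≡ (p * q′ - p′ * q) * b
      solve-b = solve-∀

    point-exists : ∀ {g h} → g ≢ h → ∀ x y → ∃ λ ℓ → point ℓ g ≡ x × point ℓ h ≡ y
    point-exists {g} {h} g≢h x y =
      let e = codet g h
          -- Cramer's formulas for the line through both points, with `c * e` in place of the
          -- inverse determinant.
          a = c * e * (β h * lift x - β g * lift y)
          b = c * e * (α g * lift y - α h * lift x)
          solved : ∀ k z → form k a b ≡ c * e * (det g h * lift z) → point (⟦ a ⟧ , ⟦ b ⟧) k ≡ z
          solved k z eq′ = lift-injective (≈-trans (lift-⟦⟧ _) (≈-trans (form-cong k (lift-⟦⟧ a) (lift-⟦⟧ b))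
            (≈-trans (≈-reflexive eq′) (det-unit g≢h (lift z)))))
      in (⟦ a ⟧ , ⟦ b ⟧) , solved g x (solve-x (c * e) (α g) (β g) (α h) (β h) (lift x) (lift y))
                         , solved h y (solve-y (c * e) (α g) (β g) (α h) (β h) (lift x) (lift y))
      where
      solve-x : ∀ k p q p′ q′ x y → p * (k * (q′ * x - q * y)) + q * (k * (p * y - p′ * x)) ≡ k * ((p * q′ - p′ * q) * x)
      solve-x = solve-∀
      solve-y : ∀ k p q p′ q′ x y → p′ * (k * (q′ * x - q * y)) + q′ * (k * (p * y - p′ * x)) ≡ k * ((p * q′ - p′ * q) * y)
      solve-y = solve-∀

Σ-Fin-↔ : ∀ {n} (z : Vec ℕ n) → Σ (Fin n) (λ i → Fin (Vec.lookup z i)) ↔ Fin (Vec.sum z)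
Σ-Fin-↔ []      = mk↔ₛ′ (λ ()) (λ ()) (λ ()) (λ ())
Σ-Fin-↔ (k ∷ z) = ↔-trans Σ-suc-↔ (↔-trans (↔-refl ⊎-↔ Σ-Fin-↔ z) (↔-sym Fin.+↔⊎))

module _ {r : ℕ} (P : Fin r → Set) where

  -- All `r` parts stay in the vertex type, but only those in `P` carry arcs; a line that has lost
  -- points to truncation keeps its type in this way.
  PartsIn : Rel (Fin r × Fin 96) 0ℓ
  PartsIn (g , _) (h , _) = g ≢ h × P g × P h

  Multipartite-embed : ∀ {u} (ι : Fin u → Fin r) → (∀ {i j} → ι i ≡ ι j → i ≡ j) → (∀ i → P (ι i)) →
                       (∀ g → P g → ∃ λ i → ι i ≡ g) → Multipartite u → Decomposable PartsIn
  Multipartite-embed {u} ι ι-injective P-ι ι-surjective D = decompose (1 , ↔-sym Fin.1↔⊤) embed-cover λ _ → D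
    where
    embed-cover : Cover {J = ⊤} {W = λ _ → Fin u × Fin 96} (λ _ → _≢_ on proj₁) PartsIn (λ _ (i , p) → ι i , p)
    embed-cover .sound _ {i , _} {j , _} i≢j = (λ eq → i≢j (ι-injective eq)) , P-ι i , P-ι j
    embed-cover .exists {g , p} {h , q} (g≢h , Pg , Ph) with ι-surjective g Pg | ι-surjective h Ph
    ... | i , refl | j , refl = tt , (i , p) , (j , q) , (λ eq → g≢h (cong ι eq)) , refl , refl
    embed-cover .unique _ _ eqᵘ eqᵛ = cong₂ (λ u v → tt , u , v)
      (cong₂ _,_ (ι-injective (cong proj₁ eqᵘ)) (cong proj₂ eqᵘ)) (cong₂ _,_ (ι-injective (cong proj₁ eqᵛ)) (cong proj₂ eqᵛ))

-- Recursion on k through a choice of m prime to 6.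

Unit12 : (m : ℕ) .{{_ : NonZero m}} → Set
Unit12 m = ∃ λ c → Modular._≈_ m (+ 12 * c) (+ 1)

-- Every k ≥ 68 lies in [4m , 6m] for some m = 6q + 5, for which 36(q+1)² - 1 = (6q+7)m.
module Induction (P : ℕ → Set₁)
  (extend : ∀ m r .{{_ : NonZero m}} → Unit12 m → r ℕ.≤ m ℕ.+ m →
            (∀ {j} → j ℕ.< 4 ℕ.* m ℕ.+ r → P j) → P (4 ℕ.* m ℕ.+ r))
  (small : ∀ k → k ℕ.≤ 19 → P k) (P-43 : P 43) where

  private
    unit-5+6q : ∀ q → Unit12 (5 ℕ.+ 6 ℕ.* q)
    unit-5+6q q = + 3 * (+ 1 + + q) * (+ 1 + + q) , Modular.congruent (+ 7 + + 6 * + q) (trans (factor (+ q)) (cong (λ z → (+ 7 + + 6 * + q) * z) cast))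
      where
      factor : ∀ x → + 12 * (+ 3 * (+ 1 + x) * (+ 1 + x)) - + 1 ≡ (+ 7 + + 6 * x) * (+ 5 + + 6 * x)
      factor = solve-∀
      cast : + 5 + + 6 * + q ≡ + (5 ℕ.+ 6 ℕ.* q)
      cast = trans (cong (λ z → + 5 + z) (sym (ℤ.pos-* 6 q))) (sym (ℤ.pos-+ 5 (6 ℕ.* q)))

    from-extend : ∀ {k} m r .{{_ : NonZero m}} → Unit12 m → r ℕ.≤ m ℕ.+ m → 4 ℕ.* m ℕ.+ r ≡ k →
                  (∀ {j} → j ℕ.< k → P j) → P k
    from-extend m r unit r≤ refl rec = extend m r unit r≤ rec

    -- For m = 7 the interval [4m, 6m] is [28, 42]. The next m prime to 6 is 11, with interval
    -- [44, 66], so 43 falls into a gap and needs a design of its own.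
    middle : ∀ d → d ℕ.≤ 12 → (∀ {j} → j ℕ.< 31 ℕ.+ d → P j) → P (31 ℕ.+ d)
    middle d d≤12 rec with ℕ.m≤n⇒m<n∨m≡n d≤12
    ... | inj₁ d<12 = extend 7 (3 ℕ.+ d) (+ 3 , Modular.congruent (+ 5) refl) (ℕ.+-monoʳ-≤ 3 (ℕ.s≤s⁻¹ d<12)) rec
    ... | inj₂ refl = P-43

    -- With k = 20 + 24q + r, the choice m = 6q + 5 gives k = 4m + r. The bound r ≤ 2m holds
    -- automatically for q ≥ 2, since then r ≤ 23 and m ≥ 17. For q = 0 and q = 1 the intervals of 5
    -- and 11 are too short, and 7 and 13 help out.
    large : ∀ q r → r ℕ.< 24 → (∀ {j} → j ℕ.< 20 ℕ.+ (r ℕ.+ q ℕ.* 24) → P j) → P (20 ℕ.+ (r ℕ.+ q ℕ.* 24))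
    large 0 r r<24 rec rewrite ℕ.+-identityʳ r with ℕ.≤-<-connex r 10
    ... | inj₁ r≤10 = extend 5 r (+ 3 , Modular.congruent (+ 7) refl) r≤10 rec
    ... | inj₂ 10<r = subst (λ r → (∀ {j} → j ℕ.< 20 ℕ.+ r → P j) → P (20 ℕ.+ r)) (ℕ.m+[n∸m]≡n 10<r)
                            (middle (r ℕ.∸ 11) (ℕ.∸-monoˡ-≤ 11 (ℕ.s≤s⁻¹ r<24))) rec
    large 1 r r<24 rec with r ℕ.≤? 22
    ... | yes r≤22 = from-extend 11 r (+ 12 , Modular.congruent (+ 13) refl) r≤22 (trans (ℕ.+-comm 44 r) (trans (sym (ℕ.+-assoc r 24 20)) (ℕ.+-comm (r ℕ.+ 24) 20))) rec
    ... | no  r≰22 with ℕ.≤-antisym (ℕ.≰⇒> r≰22) (ℕ.s≤s⁻¹ r<24)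
    -- The remaining value is 67 = 4 · 13 + 15, just past 6 · 11.
    ...   | refl = extend 13 15 (+ 12 , Modular.congruent (+ 11) refl) (ℕ.m≤m+n 15 11) rec
    large q@(suc (suc q′)) r r<24 rec =
      from-extend (5 ℕ.+ 6 ℕ.* q) r (unit-5+6q q) (ℕ.≤-trans (ℕ.<⇒≤ r<24) (ℕ.≤-trans (ℕ.m≤m+n 24 10) (ℕ.+-mono-≤ 17≤m 17≤m))) (regroup q r) rec
      where
      17≤m : 17 ℕ.≤ 5 ℕ.+ 6 ℕ.* q
      17≤m = ℕ.+-monoʳ-≤ 5 (ℕ.*-monoʳ-≤ 6 {2} {q} (ℕ.s≤s (ℕ.s≤s ℕ.z≤n)))
      regroup : ∀ q r → 4 ℕ.* (5 ℕ.+ 6 ℕ.* q) ℕ.+ r ≡ 20 ℕ.+ (r ℕ.+ q ℕ.* 24)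
      regroup q r = begin
        4 ℕ.* (5 ℕ.+ 6 ℕ.* q) ℕ.+ r      ≡⟨ cong (ℕ._+ r) (ℕ.*-distribˡ-+ 4 5 (6 ℕ.* q)) ⟩
        20 ℕ.+ 4 ℕ.* (6 ℕ.* q) ℕ.+ r     ≡⟨ ℕ.+-assoc 20 (4 ℕ.* (6 ℕ.* q)) r ⟩
        20 ℕ.+ (4 ℕ.* (6 ℕ.* q) ℕ.+ r)   ≡⟨ cong (20 ℕ.+_) (ℕ.+-comm (4 ℕ.* (6 ℕ.* q)) r) ⟩
        20 ℕ.+ (r ℕ.+ 4 ℕ.* (6 ℕ.* q))   ≡⟨ cong (λ z → 20 ℕ.+ (r ℕ.+ z)) (trans (sym (ℕ.*-assoc 4 6 q)) (ℕ.*-comm 24 q)) ⟩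
        20 ℕ.+ (r ℕ.+ q ℕ.* 24)          ∎
        where open ≡-Reasoning

    past-20 : ∀ j → (∀ {i} → i ℕ.< 20 ℕ.+ j → P i) → P (20 ℕ.+ j)
    past-20 j = subst (λ j → (∀ {i} → i ℕ.< 20 ℕ.+ j → P i) → P (20 ℕ.+ j)) (sym (ℕ.m≡m%n+[m/n]*n j 24))
                      (large (j ℕ./ 24) (j ℕ.% 24) (ℕ.m%n<n j 24))

    step : ∀ k → (∀ {j} → j ℕ.< k → P j) → P k
    step k with ℕ.≤-<-connex k 19
    ... | inj₁ k≤19 = λ _ → small k k≤19
    ... | inj₂ 19<k = subst (λ k → (∀ {j} → j ℕ.< k → P j) → P k) (ℕ.m+[n∸m]≡n 19<k) (past-20 (k ℕ.∸ 20))

  all : ∀ k → P k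
  all = <-rec P step

-- Truncating two groups of the transversal design.

module Truncation (four : Multipartite 4) (five : Multipartite 5) (six : Multipartite 6) where

  module _ (P : Fin 6 → Set) (P0 : P 0F) (P1 : P 1F) (P2 : P 2F) (P3 : P 3F) where

    private
      P-below-4 : ∀ (i : Fin 4) → P (i Fin.↑ˡ 2)
      P-below-4 0F = P0
      P-below-4 1F = P1
      P-below-4 2F = P2
      P-below-4 3F = P3

    -- The line has 4, 5 or 6 points, according to which of its points in the last two groups
    -- survive.
    truncated-block : Dec (P 4F) → Dec (P 5F) → Decomposable (PartsIn P)
    truncated-block (no ¬P4) (no ¬P5) = Multipartite-embed P (Fin._↑ˡ 2) (Fin.↑ˡ-injective 2 _ _) P-below-4
      (λ { 0F _ → 0F , refl ; 1F _ → 1F , refl ; 2F _ → 2F , refl ; 3F _ → 3F , refl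
         ; 4F P4 → contradiction P4 ¬P4 ; 5F P5 → contradiction P5 ¬P5 }) four
    truncated-block (yes P4) (no ¬P5) = Multipartite-embed P Fin.inject₁ Fin.inject₁-injective
      (λ { 0F → P0 ; 1F → P1 ; 2F → P2 ; 3F → P3 ; 4F → P4 })
      (λ { 0F _ → 0F , refl ; 1F _ → 1F , refl ; 2F _ → 2F , refl ; 3F _ → 3F , refl
         ; 4F _ → 4F , refl ; 5F P5 → contradiction P5 ¬P5 }) five
    truncated-block (no ¬P4) (yes P5) = Multipartite-embed P (Fin.punchIn 4F) (Fin.punchIn-injective 4F _ _)
      (λ { 0F → P0 ; 1F → P1 ; 2F → P2 ; 3F → P3 ; 4F → P5 })
      (λ { 0F _ → 0F , refl ; 1F _ → 1F , refl ; 2F _ → 2F , refl ; 3F _ → 3F , refl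
         ; 4F P4 → contradiction P4 ¬P4 ; 5F _ → 4F , refl }) five
    truncated-block (yes P4) (yes P5) = Multipartite-embed P id id
      (λ { 0F → P0 ; 1F → P1 ; 2F → P2 ; 3F → P3 ; 4F → P4 ; 5F → P5 }) (λ g _ → g , refl) six

  module _ (m t s : ℕ) .{{_ : NonZero m}} (c : ℤ) (12c≈1 : Modular._≈_ m (+ 12 * c) (+ 1))
           (t≤m : t ℕ.≤ m) (s≤m : s ℕ.≤ m) where

    open Transversal m c 12c≈1

    private
      sizes : Vec ℕ 6
      sizes = m ∷ m ∷ m ∷ m ∷ t ∷ s ∷ []

      size : Fin 6 → ℕ
      size = Vec.lookup sizes

      size≤m : ∀ g → size g ℕ.≤ m
      size≤m 0F = ℕ.≤-refl
      size≤m 1F = ℕ.≤-refl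
      size≤m 2F = ℕ.≤-refl
      size≤m 3F = ℕ.≤-refl
      size≤m 4F = t≤m
      size≤m 5F = s≤m

      On : Fin m × Fin m → Fin 6 → Set
      On ℓ g = toℕ (point ℓ g) ℕ.< size g

      Point′ : Set
      Point′ = Fin 6 × Fin m × Fin 96

      -- The deleted points remain as isolated points, so that all lines live in the untruncated
      -- design; `restrict` discards them afterwards.
      Across : Rel Point′ 0ℓ
      Across (g , x , _) (h , y , _) = g ≢ h × toℕ x ℕ.< size g × toℕ y ℕ.< size h

      onLine : Fin m × Fin m → Fin 6 × Fin 96 → Point′
      onLine ℓ (g , p) = g , point ℓ g , p

      -- Two points in different groups lie on exactly one line, because the two forms determine it.
      line-cover : Cover (λ ℓ → PartsIn (On ℓ)) Across onLine
      line-cover .sound ℓ r = r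
      line-cover .exists {g , x , p} {h , y , q} (g≢h , x< , y<) with point-exists g≢h x y
      ... | ℓ , refl , refl = ℓ , (g , p) , (h , q) , (g≢h , x< , y<) , refl , refl
      line-cover .unique {ℓ} {ℓ′} {g , p} {h , q} {g′ , p′} {h′ , q′} (g≢h , _) _ eqᵘ eqᵛ with cong proj₁ eqᵘ | cong proj₁ eqᵛ
      ... | refl | refl with point-unique g≢h {ℓ} {ℓ′} (cong (proj₁ ∘ proj₂) eqᵘ) (cong (proj₁ ∘ proj₂) eqᵛ)
                           | cong (proj₂ ∘ proj₂) eqᵘ | cong (proj₂ ∘ proj₂) eqᵛ
      ...   | refl | refl | refl = refl

      across : Decomposable Across
      across = decompose (Finite-Σ Finite-Fin λ _ → Finite-Fin) line-cover λ ℓ →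
        truncated-block (On ℓ) (Fin.toℕ<n _) (Fin.toℕ<n _) (Fin.toℕ<n _) (Fin.toℕ<n _)
          (toℕ (point ℓ 4F) ℕ.<? t) (toℕ (point ℓ 5F) ℕ.<? s)

      Truncated : Set
      Truncated = Σ (Fin 6) λ g → Fin (size g) × Fin 96

      untruncate : Truncated → Point′
      untruncate (g , x , p) = g , Fin.inject≤ x (size≤m g) , p

      untruncate-injective : ∀ {x y} → untruncate x ≡ untruncate y → x ≡ y
      untruncate-injective {g , x , p} {h , y , q} eq with cong proj₁ eq
      ... | refl = cong₂ (λ x p → g , x , p)
        (Fin.inject≤-injective (size≤m g) (size≤m g) x y (cong (proj₁ ∘ proj₂) eq)) (cong (proj₂ ∘ proj₂) eq)

      toℕ-untruncate< : ∀ g (x : Fin (size g)) → toℕ (Fin.inject≤ x (size≤m g)) ℕ.< size g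
      toℕ-untruncate< g x = subst (ℕ._< size g) (sym (Fin.toℕ-inject≤ x (size≤m g))) (Fin.toℕ<n x)

      truncated : Decomposable {Truncated} (_≢_ on proj₁)
      truncated = Decomposable-resp proj₁ (λ {(g , x , _)} {(h , y , _)} g≢h → g≢h , toℕ-untruncate< g x , toℕ-untruncate< h y)
        (restrict untruncate untruncate-injective
          (λ { {g , x , p} (_ , x< , _) → (g , fromℕ< x< , p) ,
               cong (λ x → g , x , p) (Fin.toℕ-injective (trans (Fin.toℕ-inject≤ _ (size≤m g)) (Fin.toℕ-fromℕ< x<))) })
          across)

    truncated-good : Good m → Good t → Good s → Good (Vec.sum sizes)
    truncated-good Gm Gt Gs = Complete-↔ (Maybe-↔ (↔-trans assoc (Σ-Fin-↔ sizes ×.×-↔ ↔-refl)))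
      (fill Fin._≟_ (7 , Maybe-Fin-↔) (λ { 0F → Gm ; 1F → Gm ; 2F → Gm ; 3F → Gm ; 4F → Gt ; 5F → Gs }) truncated)
      where
      assoc : Truncated ↔ (Σ (Fin 6) (Fin ∘ size) × Fin 96)
      assoc = mk↔ₛ′ (λ (g , x , p) → (g , x) , p) (λ ((g , x) , p) → g , x , p) (λ _ → refl) (λ _ → refl)

  extend : ∀ m r .{{_ : NonZero m}} → Unit12 m → r ℕ.≤ m ℕ.+ m →
           (∀ {j} → j ℕ.< 4 ℕ.* m ℕ.+ r → Good j) → Good (4 ℕ.* m ℕ.+ r)
  -- The excess r is split into t = min(m, r) and s = r ∸ m, both at most m and with sum r.
  extend m r (c , 12c≈1) r≤2m rec = subst Good total
    (truncated-good m (m ℕ.⊓ r) (r ℕ.∸ m) c 12c≈1 t≤m s≤m (rec m<) (rec (ℕ.≤-<-trans t≤m m<)) (rec (ℕ.≤-<-trans s≤m m<)))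
    where
    t≤m : m ℕ.⊓ r ℕ.≤ m
    t≤m = ℕ.m⊓n≤m m r
    s≤m : r ℕ.∸ m ℕ.≤ m
    s≤m = ℕ.m≤n+o⇒m∸n≤o r m r≤2m
    m< : m ℕ.< 4 ℕ.* m ℕ.+ r
    m< = ℕ.<-≤-trans (ℕ.m<m*n m 4 (ℕ.s≤s (ℕ.s≤s ℕ.z≤n))) (ℕ.≤-trans (ℕ.≤-reflexive (ℕ.*-comm m 4)) (ℕ.m≤m+n (4 ℕ.* m) r))
    regroup : ∀ m t s → m ℕ.+ (m ℕ.+ (m ℕ.+ (m ℕ.+ (t ℕ.+ (s ℕ.+ 0))))) ≡ 4 ℕ.* m ℕ.+ (t ℕ.+ s)
    regroup = solve-∀ℕ
    total : m ℕ.+ (m ℕ.+ (m ℕ.+ (m ℕ.+ (m ℕ.⊓ r ℕ.+ (r ℕ.∸ m ℕ.+ 0))))) ≡ 4 ℕ.* m ℕ.+ r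
    total = trans (regroup m (m ℕ.⊓ r) (r ℕ.∸ m)) (cong (4 ℕ.* m ℕ.+_) (ℕ.m⊓n+n∸m≡n m r))

-- The explicit difference families.

cyclic : ∀ {b} → Vec (ℕ × ℕ × ℕ) b → Vec (Vec (ℕ × ℕ) 4) b
-- Up to translation every base block contains 0. A block has 12 differences and 24 (u - 1) are
-- needed, whence 2 (u - 1) blocks.
cyclic = Vec.map λ (x , y , z) → (0 , 0) ∷ (0 , x) ∷ (0 , y) ∷ (0 , z) ∷ []

-- In both uses the multipliers fix all residues modulo 24 and have two orbits, squares and
-- nonsquares, on the nonzero residues modulo the prime u. The 48 differences of the four starting
-- blocks represent the 24 · 2 orbits once each.
multiples : ∀ {b r} → Vec (ℕ × ℕ × ℕ) b → Vec ℕ r → Vec (Vec (ℕ × ℕ) 4) (b ℕ.* r)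
multiples blocks factors =
  cyclic (Vec.concat (Vec.map (λ (x , y , z) → Vec.map (λ m → m ℕ.* x , m ℕ.* y , m ℕ.* z) factors) blocks))

-- The closing underscores below stand for proofs of `T check`, a type that evaluates to the unit
-- type when the family is correct.
abstract

  -- There is no such family over ℤ₉₆: the differences congruent to 1 modulo 4 would split into cycles through the
  -- four groups, each with sum 0, but their total is 72.
  multipartite-4 : Multipartite 4
  multipartite-4 = CyclicGDD.multipartite 4 6 4 refl
    ( ((0 , 0) ∷ (0 , 2) ∷ (1 , 15) ∷ (2 , 9) ∷ [])
    ∷ ((0 , 0) ∷ (0 , 9) ∷ (2 , 3) ∷ (2 , 14) ∷ [])
    ∷ ((0 , 0) ∷ (0 , 1) ∷ (0 , 7) ∷ (3 , 14) ∷ [])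
    ∷ ((0 , 0) ∷ (0 , 3) ∷ (1 , 1) ∷ (1 , 6) ∷ [])
    ∷ ((0 , 0) ∷ (0 , 10) ∷ (1 , 5) ∷ (3 , 3) ∷ [])
    ∷ ((0 , 0) ∷ (1 , 2) ∷ (2 , 1) ∷ (3 , 15) ∷ []) ∷ []) _

  multipartite-5 : Multipartite 5
  multipartite-5 = CyclicGDD.multipartite 1 24 5 refl (cyclic
    ((2 , 41 , 73) ∷ (4 , 72 , 103) ∷ (1 , 64 , 108) ∷ (36 , 82 , 98) ∷ (26 , 54 , 113) ∷ (6 , 9 , 102)
    ∷ (8 , 77 , 91) ∷ (23 , 42 , 109) ∷ [])) _

  multipartite-6 : Multipartite 6
  multipartite-6 = CyclicGDD.multipartite 1 24 6 refl (cyclic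
    ((19 , 21 , 76) ∷ (77 , 81 , 130) ∷ (8 , 35 , 100) ∷ (20 , 25 , 58) ∷ (17 , 64 , 73) ∷ (15 , 41 , 116)
    ∷ (31 , 93 , 143) ∷ (13 , 16 , 23) ∷ (37 , 83 , 122) ∷ (34 , 45 , 74) ∷ [])) _

  multipartite-7 : Multipartite 7
  multipartite-7 = CyclicGDD.multipartite 1 24 7 refl (cyclic
    ((40 , 135 , 141) ∷ (31 , 68 , 123) ∷ (69 , 87 , 151) ∷ (85 , 88 , 146) ∷ (20 , 36 , 46) ∷ (19 , 30 , 32)
    ∷ (25 , 121 , 159) ∷ (50 , 62 , 103) ∷ (24 , 39 , 163) ∷ (23 , 66 , 120) ∷ (74 , 78 , 167) ∷ (52 , 60 , 111) ∷ [])) _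

  multipartite-8 : Multipartite 8
  multipartite-8 = CyclicGDD.multipartite 1 24 8 refl (cyclic
    ((19 , 39 , 166) ∷ (38 , 82 , 155) ∷ (7 , 156 , 186) ∷ (3 , 84 , 137) ∷ (63 , 90 , 94) ∷ (5 , 22 , 47)
    ∷ (1 , 93 , 164) ∷ (70 , 91 , 105) ∷ (11 , 89 , 143) ∷ (23 , 106 , 158) ∷ (9 , 50 , 68) ∷ (51 , 66 , 182)
    ∷ (2 , 69 , 115) ∷ (62 , 74 , 159) ∷ [])) _

  multipartite-9 : Multipartite 9
  multipartite-9 = CyclicGDD.multipartite 1 24 9 refl (cyclic
    ((19 , 39 , 164) ∷ (79 , 138 , 143) ∷ (31 , 161 , 214) ∷ (11 , 134 , 151) ∷ (1 , 104 , 173) ∷ (10 , 13 , 97)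
    ∷ (8 , 122 , 154) ∷ (6 , 127 , 142) ∷ (21 , 50 , 96) ∷ (25 , 83 , 193) ∷ (41 , 67 , 159) ∷ (66 , 88 , 100)
    ∷ (38 , 68 , 169) ∷ (16 , 155 , 192) ∷ (14 , 42 , 49) ∷ (4 , 60 , 111) ∷ [])) _

  multipartite-10 : Multipartite 10
  multipartite-10 = CyclicGDD.multipartite 1 24 10 refl (cyclic
    ((22 , 107 , 223) ∷ (25 , 171 , 173) ∷ (35 , 84 , 87) ∷ (15 , 209 , 228) ∷ (6 , 38 , 147) ∷ (53 , 97 , 231)
    ∷ (161 , 175 , 229) ∷ (16 , 24 , 135) ∷ (4 , 61 , 193) ∷ (66 , 89 , 167) ∷ (21 , 98 , 235) ∷ (1 , 37 , 128)
    ∷ (59 , 72 , 117) ∷ (28 , 83 , 154) ∷ (43 , 165 , 207) ∷ (96 , 125 , 159) ∷ (7 , 95 , 199) ∷ (18 , 82 , 184) ∷ [])) _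

  multipartite-11 : Multipartite 11
  multipartite-11 = CyclicGDD.multipartite 1 24 11 refl (cyclic
    ((9 , 26 , 85) ∷ (79 , 216 , 256) ∷ (101 , 133 , 263) ∷ (68 , 81 , 109) ∷ (118 , 169 , 204) ∷ (39 , 167 , 197)
    ∷ (52 , 226 , 233) ∷ (25 , 140 , 142) ∷ (129 , 156 , 221) ∷ (24 , 45 , 235) ∷ (46 , 64 , 160) ∷ (49 , 152 , 252)
    ∷ (23 , 37 , 207) ∷ (3 , 116 , 126) ∷ (19 , 91 , 210) ∷ (5 , 20 , 98) ∷ (6 , 62 , 201) ∷ (42 , 89 , 248)
    ∷ (34 , 84 , 228) ∷ (71 , 153 , 260) ∷ [])) _

  multipartite-12 : Multipartite 12
  multipartite-12 = CyclicGDD.multipartite 1 24 12 refl (cyclic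
    ((18 , 135 , 187) ∷ (5 , 129 , 194) ∷ (8 , 50 , 274) ∷ (200 , 215 , 259) ∷ (75 , 268 , 284) ∷ (152 , 234 , 245)
    ∷ (46 , 113 , 146) ∷ (138 , 170 , 176) ∷ (19 , 126 , 254) ∷ (121 , 123 , 208) ∷ (90 , 220 , 241) ∷ (41 , 98 , 143)
    ∷ (7 , 70 , 233) ∷ (23 , 139 , 253) ∷ (74 , 111 , 258) ∷ (28 , 97 , 207) ∷ (71 , 202 , 205) ∷ (91 , 122 , 183)
    ∷ (51 , 127 , 140) ∷ (25 , 26 , 103) ∷ (10 , 27 , 66) ∷ (9 , 49 , 182) ∷ [])) _

  multipartite-13 : Multipartite 13
  multipartite-13 = CyclicGDD.multipartite 1 24 13 refl (cyclic
    ((22 , 213 , 285) ∷ (5 , 62 , 144) ∷ (76 , 165 , 277) ∷ (75 , 115 , 198) ∷ (246 , 261 , 289) ∷ (73 , 292 , 304)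
    ∷ (88 , 167 , 295) ∷ (126 , 187 , 309) ∷ (4 , 41 , 257) ∷ (109 , 172 , 241) ∷ (2 , 87 , 118) ∷ (245 , 287 , 301)
    ∷ (9 , 159 , 175) ∷ (32 , 192 , 294) ∷ (47 , 80 , 133) ∷ (131 , 266 , 302) ∷ (21 , 113 , 157) ∷ (38 , 68 , 138)
    ∷ (1 , 107 , 215) ∷ (64 , 218 , 252) ∷ (95 , 101 , 149) ∷ (7 , 110 , 134) ∷ (148 , 193 , 222) ∷ (84 , 235 , 254) ∷ [])) _

  multipartite-14 : Multipartite 14
  multipartite-14 = CyclicGDD.multipartite 1 24 14 refl (cyclic
    ((99 , 114 , 165) ∷ (90 , 248 , 309) ∷ (29 , 147 , 150) ∷ (39 , 269 , 279) ∷ (163 , 287 , 296) ∷ (4 , 87 , 166)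
    ∷ (11 , 146 , 334) ∷ (8 , 25 , 217) ∷ (138 , 233 , 274) ∷ (59 , 169 , 242) ∷ (75 , 130 , 306) ∷ (38 , 139 , 288)
    ∷ (60 , 107 , 292) ∷ (26 , 221 , 273) ∷ (22 , 213 , 315) ∷ (46 , 58 , 329) ∷ (131 , 181 , 259) ∷ (76 , 82 , 113)
    ∷ (68 , 122 , 142) ∷ (35 , 36 , 69) ∷ (81 , 161 , 320) ∷ (24 , 109 , 132) ∷ (93 , 164 , 236) ∷ (32 , 152 , 157)
    ∷ (116 , 134 , 245) ∷ (92 , 137 , 156) ∷ [])) _

  multipartite-15 : Multipartite 15
  multipartite-15 = CyclicGDD.multipartite 1 24 15 refl (cyclic
    ((164 , 198 , 351) ∷ (110 , 126 , 294) ∷ (61 , 119 , 152) ∷ (224 , 301 , 355) ∷ (11 , 63 , 358) ∷ (127 , 134 , 235)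
    ∷ (23 , 262 , 280) ∷ (19 , 20 , 107) ∷ (74 , 99 , 216) ∷ (249 , 313 , 316) ∷ (147 , 189 , 203) ∷ (31 , 160 , 275)
    ∷ (49 , 177 , 352) ∷ (36 , 169 , 215) ∷ (166 , 204 , 236) ∷ (41 , 199 , 312) ∷ (6 , 155 , 264) ∷ (27 , 287 , 309)
    ∷ (21 , 71 , 114) ∷ (95 , 112 , 167) ∷ (139 , 151 , 220) ∷ (40 , 137 , 163) ∷ (37 , 143 , 178) ∷ (148 , 172 , 201)
    ∷ (39 , 118 , 122) ∷ (146 , 174 , 278) ∷ (84 , 94 , 170) ∷ (92 , 154 , 222) ∷ [])) _

  multipartite-16 : Multipartite 16
  multipartite-16 = CyclicGDD.multipartite 1 24 16 refl (cyclic
    ((10 , 21 , 312) ∷ (40 , 348 , 356) ∷ (278 , 341 , 359) ∷ (65 , 70 , 338) ∷ (26 , 88 , 318) ∷ (155 , 194 , 337)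
    ∷ (124 , 231 , 371) ∷ (71 , 217 , 334) ∷ (33 , 197 , 317) ∷ (77 , 122 , 136) ∷ (52 , 125 , 362) ∷ (110 , 215 , 305)
    ∷ (102 , 201 , 236) ∷ (87 , 249 , 283) ∷ (53 , 109 , 151) ∷ (4 , 145 , 330) ∷ (29 , 133 , 171) ∷ (216 , 223 , 301)
    ∷ (103 , 118 , 130) ∷ (159 , 178 , 253) ∷ (119 , 205 , 300) ∷ (127 , 184 , 361) ∷ (123 , 126 , 132) ∷ (108 , 138 , 139)
    ∷ (24 , 113 , 115) ∷ (129 , 180 , 343) ∷ (166 , 186 , 235) ∷ (172 , 232 , 329) ∷ (174 , 191 , 347) ∷ (114 , 175 , 340) ∷ [])) _

  multipartite-17 : Multipartite 17
  multipartite-17 = CyclicGDD.multipartite 1 24 17 refl (cyclic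
    ((53 , 93 , 108) ∷ (219 , 290 , 329) ∷ (95 , 215 , 235) ∷ (145 , 258 , 359) ∷ (67 , 96 , 242) ∷ (98 , 338 , 348)
    ∷ (47 , 171 , 397) ∷ (104 , 117 , 324) ∷ (269 , 270 , 275) ∷ (164 , 319 , 392) ∷ (200 , 259 , 325) ∷ (24 , 167 , 276)
    ∷ (19 , 61 , 141) ∷ (210 , 292 , 336) ∷ (100 , 318 , 381) ∷ (37 , 246 , 322) ∷ (172 , 271 , 303) ∷ (21 , 54 , 165)
    ∷ (78 , 356 , 365) ∷ (107 , 293 , 380) ∷ (62 , 239 , 274) ∷ (7 , 38 , 334) ∷ (41 , 147 , 372) ∷ (191 , 195 , 352)
    ∷ (69 , 92 , 94) ∷ (65 , 129 , 179) ∷ (178 , 192 , 320) ∷ (159 , 181 , 333) ∷ (185 , 203 , 211) ∷ (154 , 202 , 378)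
    ∷ (160 , 163 , 311) ∷ (46 , 91 , 103) ∷ [])) _

  multipartite-18 : Multipartite 18
  multipartite-18 = CyclicGDD.multipartite 1 24 18 refl (cyclic
    ((309 , 364 , 426) ∷ (7 , 227 , 255) ∷ (63 , 105 , 251) ∷ (115 , 240 , 301) ∷ (112 , 113 , 295) ∷ (173 , 262 , 318)
    ∷ (21 , 92 , 221) ∷ (49 , 278 , 330) ∷ (74 , 100 , 310) ∷ (199 , 331 , 416) ∷ (97 , 201 , 282) ∷ (194 , 245 , 290)
    ∷ (60 , 148 , 179) ∷ (333 , 353 , 392) ∷ (48 , 339 , 382) ∷ (3 , 139 , 405) ∷ (254 , 375 , 419) ∷ (95 , 160 , 403)
    ∷ (157 , 159 , 415) ∷ (73 , 206 , 362) ∷ (91 , 354 , 395) ∷ (8 , 33 , 356) ∷ (138 , 147 , 224) ∷ (32 , 66 , 241)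
    ∷ (204 , 268 , 314) ∷ (103 , 197 , 264) ∷ (214 , 363 , 385) ∷ (152 , 163 , 279) ∷ (190 , 277 , 357) ∷ (195 , 207 , 230)
    ∷ (106 , 130 , 213) ∷ (5 , 15 , 19) ∷ (134 , 172 , 292) ∷ (82 , 135 , 193) ∷ [])) _

  -- The multipliers are 1 modulo 24 and run over the squares modulo 19.
  multipartite-19 : Multipartite 19
  multipartite-19 = CyclicGDD.multipartite 1 24 19 refl (multiples
    ((144 , 157 , 388) ∷ (242 , 245 , 444) ∷ (176 , 295 , 438) ∷ (178 , 283 , 424) ∷ [])
    (1 ∷ 25 ∷ 49 ∷ 73 ∷ 121 ∷ 169 ∷ 289 ∷ 313 ∷ 385 ∷ [])) _

  -- The multipliers are 1 modulo 24 and run over the squares modulo 43.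
  multipartite-43 : Multipartite 43
  multipartite-43 = CyclicGDD.multipartite 1 24 43 refl (multiples
    ((63 , 183 , 245) ∷ (420 , 524 , 853) ∷ (22 , 173 , 424) ∷ (646 , 652 , 841) ∷ [])
    (1 ∷ 25 ∷ 49 ∷ 97 ∷ 121 ∷ 145 ∷ 169 ∷ 193 ∷ 289 ∷ 337 ∷ 361 ∷ 385 ∷ 529 ∷ 625
    ∷ 649 ∷ 697 ∷ 745 ∷ 769 ∷ 841 ∷ 913 ∷ 961 ∷ [])) _

  -- The 96 arcs of one base block match the 96 nonzero residues modulo 97. The automorphism (a, b)
  -- ↦ (-b, a - b) of the graph multiplies the labels by 35, a primitive cube root of unity.
  good-1 : Good 1
  good-1 = good-× 1 1 97 refl (CyclicDesign.design 1 97 (Vec.map (Vec.map (Vec.map (0 ,_)))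
    (((0 ∷ 61 ∷ 19 ∷ 25 ∷ [])
      ∷ (35 ∷ 2 ∷ 53 ∷ 32 ∷ [])
      ∷ (92 ∷ 87 ∷ 83 ∷ 12 ∷ [])
      ∷ (70 ∷ 38 ∷ 69 ∷ 1 ∷ []) ∷ []) ∷ [])) _)

  good-2 : Good 2
  good-2 = good-× 2 1 193 refl (CyclicDesign.design 1 193 (Vec.map (Vec.map (Vec.map (0 ,_)))
    (((0 ∷ 142 ∷ 10 ∷ 123 ∷ [])
      ∷ (89 ∷ 103 ∷ 75 ∷ 187 ∷ [])
      ∷ (115 ∷ 27 ∷ 68 ∷ 124 ∷ [])
      ∷ (160 ∷ 145 ∷ 21 ∷ 155 ∷ []) ∷ [])
    ∷ ((0 ∷ 10 ∷ 104 ∷ 44 ∷ [])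
      ∷ (115 ∷ 29 ∷ 8 ∷ 92 ∷ [])
      ∷ (38 ∷ 165 ∷ 51 ∷ 93 ∷ [])
      ∷ (120 ∷ 157 ∷ 64 ∷ 68 ∷ []) ∷ []) ∷ [])) _)

  -- A label (a, c) stands for a + c√3 in the field with 289 elements, where 8 + 2√3 is a primitive
  -- cube root of unity.
  good-3 : Good 3
  good-3 = good-× 3 17 17 refl (CyclicDesign.design 17 17 
    ((((0 , 0) ∷ (8 , 2) ∷ (6 , 2) ∷ (3 , 13) ∷ [])
      ∷ ((1 , 0) ∷ (0 , 8) ∷ (5 , 4) ∷ (16 , 5) ∷ [])
      ∷ ((2 , 4) ∷ (11 , 5) ∷ (9 , 11) ∷ (13 , 8) ∷ [])
      ∷ ((14 , 13) ∷ (16 , 11) ∷ (7 , 1) ∷ (8 , 15) ∷ []) ∷ [])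
    ∷ (((0 , 0) ∷ (2 , 16) ∷ (9 , 6) ∷ (6 , 12) ∷ [])
      ∷ ((5 , 5) ∷ (1 , 6) ∷ (0 , 11) ∷ (2 , 3) ∷ [])
      ∷ ((2 , 13) ∷ (11 , 12) ∷ (6 , 15) ∷ (15 , 3) ∷ [])
      ∷ ((10 , 16) ∷ (7 , 16) ∷ (16 , 6) ∷ (10 , 13) ∷ []) ∷ [])
    ∷ (((0 , 0) ∷ (12 , 5) ∷ (16 , 7) ∷ (6 , 5) ∷ [])
      ∷ ((15 , 16) ∷ (10 , 1) ∷ (12 , 4) ∷ (4 , 8) ∷ [])
      ∷ ((1 , 7) ∷ (14 , 13) ∷ (0 , 3) ∷ (1 , 5) ∷ [])
      ∷ ((1 , 11) ∷ (3 , 13) ∷ (0 , 8) ∷ (7 , 13) ∷ []) ∷ []) ∷ []) _)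

small : ∀ k → k ℕ.≤ 19 → Good k
small 0 _ = good-0
small 1 _ = good-1
small 2 _ = good-2
small 3 _ = good-3
small 4 _ = Multipartite⇒Good good-1 multipartite-4
small 5 _ = Multipartite⇒Good good-1 multipartite-5
small 6 _ = Multipartite⇒Good good-1 multipartite-6
small 7 _ = Multipartite⇒Good good-1 multipartite-7
small 8 _ = Multipartite⇒Good good-1 multipartite-8
small 9 _ = Multipartite⇒Good good-1 multipartite-9
small 10 _ = Multipartite⇒Good good-1 multipartite-10
small 11 _ = Multipartite⇒Good good-1 multipartite-11
small 12 _ = Multipartite⇒Good good-1 multipartite-12
small 13 _ = Multipartite⇒Good good-1 multipartite-13
small 14 _ = Multipartite⇒Good good-1 multipartite-14
small 15 _ = Multipartite⇒Good good-1 multipartite-15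
small 16 _ = Multipartite⇒Good good-1 multipartite-16
small 17 _ = Multipartite⇒Good good-1 multipartite-17
small 18 _ = Multipartite⇒Good good-1 multipartite-18
small 19 _ = Multipartite⇒Good good-1 multipartite-19
small (suc (suc (suc (suc (suc (suc (suc (suc (suc (suc (suc (suc (suc (suc (suc (suc (suc (suc (suc (suc k)))))))))))))))))))) 20+k≤19 =
  contradiction 20+k≤19 (ℕ.m+n≮m 19 k)

-- Translation between `Complete` and `Design`.

module _ {n : ℕ} (D : Complete (Fin n)) where

  private
    -- If `u` and `v` had the same image, the arcs from them to a common neighbour would too, and an
    -- arc of the complete graph is covered only once.
    place-injective : ∀ i {u v} → place D i u ≡ place D i v → u ≡ v
    place-injective i {u} {v} eq =
      let w , u~w , v~w = ~-common-neighbour u v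
      in cong (proj₁ ∘ proj₂) (unique (cover D) u~w v~w eq refl)

    In? : ∀ i x → Dec (∃ λ u → place D i u ≡ x)
    In? i x = map′ (λ (a , b , eq) → (a , b) , eq) (λ ((a , b) , eq) → a , b , eq)
                   (Fin.any? λ a → Fin.any? λ b → place D i (a , b) Fin.≟ x)

    EdgeOf : Index D → Rel (Fin n) 0ℓ
    EdgeOf i x y = ∃ λ u → ∃ λ v → u ~ v × place D i u ≡ x × place D i v ≡ y

    subgraph : Index D → Subgraph (complete n)
    subgraph i = record
      { vertices  = λ x → ⌊ In? i x ⌋
      ; Edge      = EdgeOf i
      ; edge-sym  = λ (u , v , adjacent u~v , eqᵘ , eqᵛ) → v , u , adjacent (symm shrikhande {u} {v} u~v) , eqᵛ , eqᵘ
      ; edge⇒adj  = λ { (u , v , u~v , refl , refl) → sound (cover D) i u~v }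
      ; edge⇒vert = λ (u , v , _ , eqᵘ , eqᵛ) → fromWitness (u , eqᵘ) , fromWitness (v , eqᵛ)
      }

    subgraph≅ : ∀ i → Subgraph.graph (subgraph i) ≅ shrikhande
    subgraph≅ i = record
      { bijection = mk↔ₛ′ name (λ u → place D i u , fromWitness (u , refl))
                          (λ u → place-injective i (place-name (place D i u , fromWitness (u , refl))))
                          (λ x → vertex-≡ (place-name x))
      ; adjacency = λ x y → mk⇔
          (λ (u , v , u~v , eqᵘ , eqᵛ) → _~_.adjacency (named {x} {y} u~v eqᵘ eqᵛ))
          (λ nx~ny → name x , name y , adjacent nx~ny , place-name x , place-name y)
      }
      where
      name : Subgraph.Vertex (subgraph i) → Vertex
      name (_ , t) = proj₁ (toWitness t)
      place-name : ∀ x → place D i (name x) ≡ proj₁ x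
      place-name (_ , t) = proj₂ (toWitness t)
      named : ∀ {x y u v} → u ~ v → place D i u ≡ proj₁ x → place D i v ≡ proj₁ y → name x ~ name y
      named {x} {y} u~v eqᵘ eqᵛ = subst₂ _~_ (place-injective i (trans eqᵘ (sym (place-name x))))
                                             (place-injective i (trans eqᵛ (sym (place-name y)))) u~v
      vertex-≡ : ∀ {x y : Subgraph.Vertex (subgraph i)} → proj₁ x ≡ proj₁ y → x ≡ y
      vertex-≡ {x , t} {_ , t′} refl = cong (x ,_) (T-irrelevant t t′)

    module I = Inverse (proj₂ (finite D))

  Complete⇒Design : Design shrikhande n
  Complete⇒Design = record
    { size      = proj₁ (finite D)
    ; block     = subgraph ∘ I.from
    ; block≅    = subgraph≅ ∘ I.from
    ; partition = partition
    }
    where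
    partition : ∀ {x y} → x ≢ y → ∃! _≡_ λ j → EdgeOf (I.from j) x y
    partition x≢y with exists (cover D) x≢y
    ... | i , u , v , u~v , refl , refl =
      I.to i , subst (λ i′ → EdgeOf i′ (place D i u) (place D i v)) (sym (I.strictlyInverseʳ i)) (u , v , u~v , refl , refl) ,
      λ { {j} (u′ , v′ , u′~v′ , eqᵘ , eqᵛ) →
          trans (cong (I.to ∘ proj₁) (unique (cover D) u~v u′~v′ (sym eqᵘ) (sym eqᵛ))) (I.strictlyInverseˡ j) }

Design⇒Complete : ∀ {n} → Design shrikhande n → Complete (Fin n)
Design⇒Complete {n} d = record { Index = Fin size ; finite = Finite-Fin ; place = place′ ; cover = cover′ }
  where
  open Decomposition d
  module _ (i : Fin size) where
    open Inverse (_≅_.bijection (block≅ i)) public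
    adj : ∀ x y → Subgraph.Edge (block i) (proj₁ x) (proj₁ y) ⇔ Adj shrikhande (to x) (to y)
    adj = _≅_.adjacency (block≅ i)

  place′ : Fin size → Vertex → Fin n
  place′ i u = proj₁ (from i u)

  edge : ∀ i {u v} → u ~ v → Subgraph.Edge (block i) (place′ i u) (place′ i v)
  edge i {u} {v} (adjacent u~v) = Equivalence.from (adj i (from i u) (from i v))
    (subst₂ (Adj shrikhande) (sym (strictlyInverseˡ i u)) (sym (strictlyInverseˡ i v)) u~v)

  place′-to : ∀ i x → place′ i (to i x) ≡ proj₁ x
  place′-to i x = cong proj₁ (strictlyInverseʳ i x)

  place′-injective : ∀ i {u v} → place′ i u ≡ place′ i v → u ≡ v
  place′-injective i {u} {v} eq = trans (sym (strictlyInverseˡ i u)) (trans (cong (to i) (vertex-≡ eq)) (strictlyInverseˡ i v))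
    where
    vertex-≡ : ∀ {x y : Subgraph.Vertex (block i)} → proj₁ x ≡ proj₁ y → x ≡ y
    vertex-≡ {x , t} {_ , t′} refl = cong (x ,_) (T-irrelevant t t′)

  same-block : ∀ {x y i j} → x ≢ y → Subgraph.Edge (block i) x y → Subgraph.Edge (block j) x y → i ≡ j
  same-block x≢y eᵢ eⱼ = let _ , _ , least = partition x≢y in trans (sym (least eᵢ)) (least eⱼ)

  cover′ : Cover (λ _ → _~_) _≢_ place′
  cover′ .sound i u~v = Subgraph.edge⇒adj (block i) (edge i u~v)
  cover′ .exists {x} {y} x≢y =
    let i , e , _ = partition x≢y
        tˣ , tʸ = Subgraph.edge⇒vert (block i) e
    in i , to i (x , tˣ) , to i (y , tʸ) , adjacent (Equivalence.to (adj i (x , tˣ) (y , tʸ)) e) ,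
       place′-to i (x , tˣ) , place′-to i (y , tʸ)
  cover′ .unique {i} {j} {u} {v} {u′} {v′} u~v u′~v′ eqᵘ eqᵛ =
    lemma (same-block (Subgraph.edge⇒adj (block i) (edge i u~v)) (edge i u~v)
            (subst₂ (Subgraph.Edge (block j)) (sym eqᵘ) (sym eqᵛ) (edge j u′~v′))) eqᵘ eqᵛ
    where
    lemma : ∀ {i j} → i ≡ j → place′ i u ≡ place′ j u′ → place′ i v ≡ place′ j v′ → (i , u , v) ≡ (j , u′ , v′)
    lemma {i} refl eqᵘ eqᵛ = cong₂ (λ u v → i , u , v) (place′-injective i eqᵘ) (place′-injective i eqᵛ)

-- Necessity: counting flags, and divisibility.

Finite-Dec : ∀ {A : Set} → Dec A → (∀ (a b : A) → a ≡ b) → Finite A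
Finite-Dec (yes a) irr = 1 , mk↔ₛ′ (λ _ → zero) (λ _ → a) (λ { zero → refl }) (irr a)
Finite-Dec (no ¬a) _   = 0 , mk↔ₛ′ (λ a → contradiction a ¬a) (λ ()) (λ ()) (λ a → contradiction a ¬a)

module Counting {n : ℕ} (D : Complete (Fin (suc n))) where

  Flag : Set
  Flag = Index D × Vertex

  centre : Flag → Fin (suc n)
  centre (i , u) = place D i u

  At : Fin (suc n) → Set
  At x = Σ Flag λ φ → centre φ ≡ x

  -- Each other point is the end of exactly one arc from `x`, and such an arc is a flag at `x`
  -- together with one of the 6 connection elements. Punching out `x` numbers the other points by
  -- `Fin n`.
  star : ∀ x → (At x × Fin 6) ↔ Fin n
  star x = mk↔ₛ′ to from to∘from from∘to
    where
    end : At x × Fin 6 → Fin (suc n)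
    end (((i , u) , _) , c) = place D i (neighbour u c)

    x≢end : ∀ a → x ≢ end a
    x≢end (((i , u) , refl) , c) = sound (cover D) i (~-neighbour u c)

    end-injective : ∀ {a b} → end a ≡ end b → a ≡ b
    end-injective {((i , u) , refl) , c} {((j , v) , eq) , d} eq′
      with unique (cover D) (~-neighbour u c) (~-neighbour v d) (sym eq) eq′
    ... | p with cong proj₁ p | cong (proj₁ ∘ proj₂) p
    ... | refl | refl with eq | neighbour-injective u {c} {d} (cong (proj₂ ∘ proj₂) p)
    ... | refl | refl = refl

    end-surjective : ∀ {y} → x ≢ y → ∃ λ a → end a ≡ y
    end-surjective x≢y with exists (cover D) x≢y
    ... | i , u , v , u~v , refl , refl with ~⇒neighbour u~v
    ... | c , refl = (((i , u) , refl) , c) , refl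

    to : At x × Fin 6 → Fin n
    to a = Fin.punchOut (x≢end a)

    from : Fin n → At x × Fin 6
    from y = proj₁ (end-surjective (Fin.punchInᵢ≢i x y ∘ sym))

    end-from : ∀ y → end (from y) ≡ Fin.punchIn x y
    end-from y = proj₂ (end-surjective (Fin.punchInᵢ≢i x y ∘ sym))

    to∘from : ∀ y → to (from y) ≡ y
    to∘from y = Fin.punchIn-injective x _ _ (trans (Fin.punchIn-punchOut (x≢end (from y))) (end-from y))

    from∘to : ∀ a → from (to a) ≡ a
    from∘to a = end-injective (trans (end-from (to a)) (Fin.punchIn-punchOut (x≢end a)))

  Finite-At : ∀ x → Finite (At x)
  Finite-At x = Finite-Σ (Finite-Σ (finite D) λ _ → 16 , ↔-sym Fin.*↔×) λ φ →
    Finite-Dec (centre φ Fin.≟ x) λ { refl refl → refl }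

  degree : ∃ λ r → r ℕ.* 6 ≡ n
  degree = let r , At↔r = Finite-At zero in
    r , ↔⇒≡ (↔-trans Fin.*↔× (↔-trans (↔-sym At↔r ×.×-↔ ↔-refl) (star zero)))

  -- Double counting of ordered pairs of distinct points: 16 · 6 arcs in each block on one side, the
  -- stars of all points on the other.
  edges : ∃ λ b → (b ℕ.* 16) ℕ.* 6 ≡ suc n ℕ.* n
  edges = proj₁ (finite D) , ↔⇒≡ (↔-trans Fin.*↔× (↔-trans (flags ×.×-↔ ↔-refl) (↔-trans regroup
    (↔-trans (Σ.Σ-↔ ↔-refl (λ {x} → star x)) (↔-sym Fin.*↔×)))))
    where
    flags : Fin (proj₁ (finite D) ℕ.* 16) ↔ Flag
    flags = ↔-trans Fin.*↔× (↔-sym (proj₂ (finite D)) ×.×-↔ Fin.*↔×)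
    regroup : (Flag × Fin 6) ↔ Σ (Fin (suc n)) (λ x → At x × Fin 6)
    regroup = mk↔ₛ′ (λ (φ , c) → centre φ , (φ , refl) , c) (λ (_ , (φ , _) , c) → φ , c) (λ { (_ , (_ , refl) , _) → refl }) (λ _ → refl)

-- One factor 2 at a time: by Euclid's lemma the prime 2 divides `b`, and it is cancelled from both
-- sides.
2^-∣-cancel : ∀ k {a b} → ¬ 2 ℕ.∣ a → 2 ℕ.^ k ℕ.∣ a ℕ.* b → 2 ℕ.^ k ℕ.∣ b
2^-∣-cancel zero    {b = b} _ _ = ℕ.1∣ b
2^-∣-cancel (suc k) {a} {b} 2∤a 2^∣ab with ℕ.euclidsLemma a b ℕ.prime[2] (ℕ.∣-trans (ℕ.m∣m*n (2 ℕ.^ k)) 2^∣ab)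
... | inj₁ 2∣a = contradiction 2∣a 2∤a
... | inj₂ (ℕ.divides b′ refl) = subst (2 ℕ.* 2 ℕ.^ k ℕ.∣_) (ℕ.*-comm 2 b′) (ℕ.*-monoʳ-∣ 2 (2^-∣-cancel k 2∤a
  (ℕ.*-cancelˡ-∣ 2 (subst (2 ℕ.* 2 ℕ.^ k ℕ.∣_) (trans (sym (ℕ.*-assoc a b′ 2)) (ℕ.*-comm (a ℕ.* b′) 2)) 2^∣ab))))

-- With n = 6r the edge count becomes (6r + 1) r = 16b after cancelling 6. Since 6r + 1 is odd, 16
-- divides r, and so 96 divides n.
admissible : ∀ n r b → r ℕ.* 6 ≡ n → (b ℕ.* 16) ℕ.* 6 ≡ suc n ℕ.* n → suc n ℕ.% 96 ≡ 1
admissible _ r b refl eq = conclude (2^-∣-cancel 4 2∤n (ℕ.divides b (ℕ.*-cancelʳ-≡ _ _ 6 (trans (ℕ.*-assoc (suc (r ℕ.* 6)) r 6) (sym eq)))))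
  where
  2∤n : ¬ 2 ℕ.∣ suc (r ℕ.* 6)
  2∤n 2∣n = contradiction (ℕ.∣m+n∣m⇒∣n (subst (2 ℕ.∣_) (ℕ.+-comm 1 (r ℕ.* 6)) 2∣n) (ℕ.∣n⇒∣m*n r (ℕ.divides 3 refl))) (from-no (2 ℕ.∣? 1))
  conclude : 16 ℕ.∣ r → suc (r ℕ.* 6) ℕ.% 96 ≡ 1
  conclude (ℕ.divides e refl) = trans (cong (λ k → suc k ℕ.% 96) (ℕ.*-assoc e 16 6)) (ℕ.[m+kn]%n≡m%n 1 e 96)

theorem2p1 : (n : ℕ) → n > 0 → Design shrikhande n ⇔ (n % 96 ≡ 1)
theorem2p1 n@(suc n′) _ = mk⇔ necessary sufficient
  where
  necessary : Design shrikhande n → n ℕ.% 96 ≡ 1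
  necessary d = let open Counting (Design⇒Complete d) ; r , deg = degree ; b , edg = edges in admissible n′ r b deg edg
  sufficient : n ℕ.% 96 ≡ 1 → Design shrikhande n
  sufficient n%96≡1 = subst (Design shrikhande)
    (sym (trans (ℕ.m≡m%n+[m/n]*n n 96) (cong (ℕ._+ n ℕ./ 96 ℕ.* 96) n%96≡1)))
    (Complete⇒Design (Complete-↔ (↔-trans (Maybe-↔ (↔-sym Fin.*↔×)) Maybe-Fin-↔)
      (Induction.all Good (Truncation.extend multipartite-4 multipartite-5 multipartite-6) small
         (Multipartite⇒Good good-1 multipartite-43) (n ℕ./ 96))))
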